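{- Let $p>2$ be a prime and let $m\geq3$ be an integer with $\gcd(p,m)=1$. Let $u$ be the order of $p$ modulo $2m$, i.e., the smallest positive integer with $p^u\equiv1\pmod{2m}$. Let $\zeta_4$ and $\zeta_{2m}$ be roots of the cyclotomic polynomials $\Phi_4(x)$ and $\Phi_{2m}(x)$, respectively, in an algebraic closure of $\mathbb{Z}_p$, let $s$ be an integer with $\gcd(s,m)=1$, and let $\delta$ be the degree of the minimal polynomial of $\zeta_4\left(\zeta_{2m}^s+\zeta_{2m}^{ -s}\right)$ over $\mathbb{Z}_p$. Then - $\delta=\frac{u}{2}$ if $p\equiv1\pmod4$, $u$ is even, and $p^{u/2}\equiv-1\pmod{2m}$; or $p\equiv3\pmod4$, $u\equiv0\pmod4$, and $p^{u/2}\equiv-1\pmod{2m}$; or $p\equiv3\pmod4$, $u\equiv2\pmod4$, and $p^{u/2}\equiv m\pm1\pmod{2m}$; - $\delta=u$ if $p\equiv1\pmod4$, $u$ is even, and $p^{u/2}\not\equiv-1\pmod{2m}$; or $p\equiv1\pmod4$ and $u$ is odd; or $p\equiv3\pmod4$, $u\equiv0\pmod4$, and $p^{u/2}\not\equiv-1\pmod{2m}$; or $p\equiv3\pmod4$, $u\equiv2\pmod4$, and $p^{u/2}\not\equiv m\pm1\pmod{2m}$; - $\delta=2u$ if $p\equiv3\pmod4$ and $u$ is odd.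
   Context: $\mathbb{Z}_p$ denotes the field with $p$ elements. "$p^{u/2}\equiv m\pm1\pmod{2m}$" means $p^{u/2}$ is congruent to $m+1$ or to $m-1$ modulo $2m$; "$\not\equiv m\pm1$" means congruent to neither. -}

module Defs where

open import Level using (_⊔_) renaming (suc to lsuc)
open import Data.Nat as ℕ using (ℕ; zero; suc; _∸_; _≤_; _<_)
open import Data.Nat.Divisibility using (_∣?_)
open import Data.Integer as ℤ using (ℤ; +_; -[1+_])
open import Data.Integer.Divisibility as ℤD using ()
open import Data.Fin using (Fin; toℕ)
open import Data.Vec using (Vec; []; _∷_)
open import Data.List as List using (List; []; _∷_; _++_; length; reverse; replicate; filter)
open import Data.Product using (_×_; _,_; proj₁; proj₂; ∃)
open import Algebra.Bundles using (CommutativeRing)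
open import Relation.Nullary using (¬_)
open import Relation.Binary.PropositionalEquality using (_≡_)

infix 4 _≡ᵢ_[mod_]
_≡ᵢ_[mod_] : ℤ → ℤ → ℕ → Set
a ≡ᵢ b [mod n ] = (+ n) ℤD.∣ (a ℤ.- b)

IsOrderMod : ℕ → ℕ → ℕ → Set
IsOrderMod p n u =
  (1 ≤ u) × (+ (p ℕ.^ u) ≡ᵢ + 1 [mod n ]) ×
  (∀ k → 1 ≤ k → k < u → ¬ (+ (p ℕ.^ k) ≡ᵢ + 1 [mod n ]))

-- Integer polynomials, represented as coefficient lists (lowest degree
-- first), and the cyclotomic polynomials Φ_n over ℤ, defined by
--   x^n - 1 = ∏_{d ∣ n} Φ_d ,  i.e.  Φ_n = (x^n - 1) / ∏_{d ∣ n, d < n} Φ_d.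

ZPoly : Set
ZPoly = List ℤ

addP : ZPoly → ZPoly → ZPoly
addP [] q = q
addP (a ∷ p) [] = a ∷ p
addP (a ∷ p) (b ∷ q) = (a ℤ.+ b) ∷ addP p q

scaleP : ℤ → ZPoly → ZPoly
scaleP c = List.map (c ℤ.*_)

mulP : ZPoly → ZPoly → ZPoly
mulP [] q = []
mulP (a ∷ p) q = addP (scaleP a q) (+ 0 ∷ mulP p q)

prodP : List ZPoly → ZPoly
prodP = List.foldr mulP (+ 1 ∷ [])

xn-1 : ℕ → ZPoly
xn-1 zero = []
xn-1 (suc n) = ℤ.- (+ 1) ∷ (replicate n (+ 0) ++ (+ 1 ∷ []))

-- A - c * B on coefficient lists (highest degree first), B shorter.
private
  subScaled : List ℤ → ℤ → List ℤ → List ℤ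
  subScaled A c [] = A
  subScaled [] c (b ∷ B) = []
  subScaled (a ∷ A) c (b ∷ B) = (a ℤ.- c ℤ.* b) ∷ subScaled A c B

  tailL : List ℤ → List ℤ
  tailL [] = []
  tailL (_ ∷ xs) = xs

  -- synthetic division by a monic polynomial, highest degree first
  divHF : ℕ → List ℤ → List ℤ → List ℤ
  divHF zero A B = []
  divHF (suc f) [] B = []
  divHF (suc f) (a ∷ A) B = a ∷ divHF f (subScaled A a (tailL B)) B

divMonic : ZPoly → ZPoly → ZPoly
divMonic a b =
  reverse (divHF (suc (length a ∸ length b)) (reverse a) (reverse b))

cycTable : ℕ → List (ℕ × ZPoly)
cycTable zero = []
cycTable (suc n) =
  cycTable n ++
  ((suc n , divMonic (xn-1 (suc n))
              (prodP (List.map proj₂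
                (filter (λ dp → proj₁ dp ∣? suc n) (cycTable n))))) ∷ [])

-- the n-th cyclotomic polynomial Φ_n (n ≥ 1; Φ_0 := 1 by convention)
cyclotomic : ℕ → ZPoly
cyclotomic zero = + 1 ∷ []
cyclotomic (suc n) =
  divMonic (xn-1 (suc n))
    (prodP (List.map proj₂
      (filter (λ dp → proj₁ dp ∣? suc n) (cycTable n))))

record Field c ℓ : Set (lsuc (c ⊔ ℓ)) where
  field
    commutativeRing : CommutativeRing c ℓ
  open CommutativeRing commutativeRing public
  field
    _⁻¹     : Carrier → Carrier
    1≉0     : ¬ (1# ≈ 0#)
    inverse : ∀ x → ¬ (x ≈ 0#) → (x ⁻¹) * x ≈ 1#

module FieldOps {c ℓ} (F : Field c ℓ) where
  open Field F

  fromℕ : ℕ → Carrier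
  fromℕ zero = 0#
  fromℕ (suc n) = 1# + fromℕ n

  fromℤ : ℤ → Carrier
  fromℤ (+ n) = fromℕ n
  fromℤ -[1+ n ] = - fromℕ (suc n)

  pow : Carrier → ℕ → Carrier
  pow x zero = 1#
  pow x (suc n) = x * pow x n

  zpow : Carrier → ℤ → Carrier
  zpow x (+ n) = pow x n
  zpow x -[1+ n ] = pow (x ⁻¹) (suc n)

  evalℤ : ZPoly → Carrier → Carrier
  evalℤ [] x = 0#
  evalℤ (a ∷ as) x = fromℤ a + x * evalℤ as x

  HasChar : ℕ → Set ℓ
  HasChar p = fromℕ p ≈ 0#

  -- value at x of the monic polynomial x^d + c_{d-1} x^{d-1} + … + c_0
  -- with coefficients c_i ∈ F (given lowest degree first)
  evalMonic : ∀ {d} → Vec Carrier d → Carrier → Carrier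
  evalMonic [] x = 1#
  evalMonic (c ∷ cs) x = c + x * evalMonic cs x

  AlgClosed : Set (c ⊔ ℓ)
  AlgClosed = ∀ d (cs : Vec Carrier (suc d)) → ∃ λ x → evalMonic cs x ≈ 0#

  -- coefficients in ℤ_p = Fin p, mapped into F (which has characteristic p)
  embed : ∀ {p} → Fin p → Carrier
  embed i = fromℕ (toℕ i)

  evalMonicℤp : ∀ {p d} → Vec (Fin p) d → Carrier → Carrier
  evalMonicℤp [] x = 1#
  evalMonicℤp (c ∷ cs) x = embed c + x * evalMonicℤp cs x

  RootOfMonicDeg : ℕ → Carrier → ℕ → Set ℓ
  RootOfMonicDeg p α d = ∃ λ (cs : Vec (Fin p) d) → evalMonicℤp cs α ≈ 0#

  MinPolyDegree : ℕ → Carrier → ℕ → Set ℓ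
  MinPolyDegree p α δ =
    RootOfMonicDeg p α δ × (∀ d → d < δ → ¬ RootOfMonicDeg p α d)

{-# OPTIONS --safe #-}
-- A root ζ of Φ_N in a field where N ≠ 0 has exact order N: by induction on d ∣ N the product of
-- the Φ_e with e ∣ d is x^d − 1, because the product over the proper divisors has as many distinct roots
-- as its degree, all of them roots of x^d − 1; double roots are excluded by evaluating at a + ε with ε² = 0.
-- By Frobenius, the degree of α over ℤ_p is the least k ≥ 1 with α^(p^k) = α: the conjugates α^(p^i) are
-- roots of every polynomial over ℤ_p vanishing at α, and ∏_{i<k} (x − α^(p^i)) has coefficients in ℤ_p.
-- For α = ζ₄ (η + η⁻¹) with η = ζ^s and q = p^k, α^q = ±ζ₄ (η^q + η^(−q)), and
-- η^q + η^(−q) ∓ (η + η⁻¹) = (η^(q−1) ∓ 1) (η ∓ η^(−q)); hence α^q = α exactly when q ≡ 1 (mod 4) and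
-- q ≡ ±1 (mod 2m), or q ≡ 3 (mod 4) and q ≡ m ± 1 (mod 2m). The least such k is found from u.
-- Equality in the field is not decidable, so existence statements are proved up to double negation;
-- this suffices because the conclusions are equations between natural numbers.
module Submission where

open import Defs
open import Level using (_⊔_)
open import Algebra.Bundles using (AbelianGroup; CommutativeRing; RawRing)
import Algebra.Construct.DirectProduct as DirectProduct
import Algebra.Properties.CommutativeSemiring.Binomial as Binomial
import Algebra.Properties.CommutativeSemiring.Exp as CommutativeExp
import Algebra.Properties.Ring
import Algebra.Properties.Semiring.Exp
import Algebra.Properties.Semiring.Mult as Mult
import Algebra.Properties.Semiring.Sum as Sum
import Algebra.Solver.Ring
open import Algebra.Solver.Ring.AlmostCommutativeRing using (fromCommutativeRing; _-Raw-AlmostCommutative⟶_; Induced-equivalence)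
open import Data.Empty using (⊥; ⊥-elim)
open import Data.Fin as Fin using (Fin; toℕ; fromℕ<)
import Data.Fin.Properties as Finₚ
open import Data.Integer as ℤ using (ℤ; +_; -[1+_]; ∣_∣)
import Data.Integer.Divisibility.Signed as Signed
import Data.Integer.Properties as ℤₚ
open import Data.Integer.Tactic.RingSolver using (solve-∀)
open import Data.List using (List; []; _∷_; _++_; length; reverse; foldl; replicate; map; filter; applyUpTo)
open import Data.List.Membership.Propositional using (_∈_)
open import Data.List.Membership.Propositional.Properties using (∈-++⁺ˡ; ∈-++⁺ʳ; ∈-filter⁺; ∈-map⁺)
import Data.List.Properties as Listₚ
open import Data.List.Relation.Unary.All as All using (All; []; _∷_)
import Data.List.Relation.Unary.All.Properties as Allₚ
open import Data.List.Relation.Unary.AllPairs using (AllPairs; []; _∷_)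
import Data.List.Relation.Unary.AllPairs.Properties as AllPairsₚ
open import Data.List.Relation.Unary.Any as Any using (Any; here; there)
import Data.List.Relation.Unary.Any.Properties as Anyₚ
open import Data.Maybe using (just; nothing)
open import Data.Nat as ℕ using (ℕ; zero; suc; _≤_; _<_; _∸_; _!; z≤n; s≤s)
open import Data.Nat.Combinatorics using (_C_; nCn≡1; nCk≡n!/k![n-k]!; k![n∸k]!∣n!)
open import Data.Nat.Coprimality as Coprimality using (Coprime; coprime-divisor; prime⇒coprime; coprime-Bézout)
open import Data.Nat.Divisibility using (_∣_; _∣?_; divides; ∣⇒≤; ∣1⇒≡1; 0∣⇒≡0; ∣-refl; ∣-trans; *-cancelˡ-∣; *-monoʳ-∣; ∣m+n∣m⇒∣n; ∣m∣n⇒∣m+n; m∣m*n; n∣m*n; ∣n⇒∣m*n; m%n≡0⇒n∣m)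
open import Data.Nat.DivMod using (_%_; _/_; m≡m%n+[m/n]*n; m%n<n; m*n/n≡m; m/n*n≡m)
open import Data.Nat.GCD using (gcd; gcd-GCD; gcd[m,n]∣m; gcd[m,n]∣n; module Bézout)
open import Data.Nat.Induction using (<-rec)
open import Data.Nat.Primality using (Prime; euclidsLemma; prime⇒irreducible; prime⇒nonTrivial)
import Data.Nat.Properties as ℕₚ
import Data.Nat.Tactic.RingSolver as ℕ-Solver
open import Data.Product using (_×_; _,_; proj₁; proj₂; ∃)
open import Data.Sum using (_⊎_; inj₁; inj₂)
open import Data.Vec as Vec using (Vec; []; _∷_; _∷ʳ_)
import Data.Vec.Relation.Unary.All as VecAll
open VecAll using ([]; _∷_)
open import Function using (_∘_)
open import Relation.Binary.Definitions using (WeaklyDecidable)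
open import Relation.Binary.PropositionalEquality as ≡ using (_≡_; cong; cong₂; subst; module ≡-Reasoning)
import Relation.Binary.Reasoning.Setoid
open import Relation.Nullary using (¬_; Dec; yes; no)
open import Relation.Nullary.Decidable using (_×-dec_; _⊎-dec_; decidable-stable)

-- The division that defines Φ_d discards its remainder, so x^d - 1 = ∏ Φ_e cannot be read off the
-- definition. It is never proved over ℤ: exactness is obtained for values in the field by counting
-- roots. Exactness at d needs the roots of the Φ_e for the proper divisors e to be distinct, hence
-- exact orders, and exact orders come from exactness at divisors; the induction carries both.
-- Values in the field alone cannot see multiplicities, so the identity is carried at the points a +
-- ε.
--
-- The hypothesis gcd(s, m) = 1 admits even s when m is odd, and then η has order m instead of 2m.
-- The conditions on q can still be read modulo 2m because q is odd: only the even exponents q - 1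
-- and q + 1 of η occur.
--
-- An odd q ≡ m ± 1 (mod 2m) forces m to be even, and then (m ± 1)² ≡ 1 (mod 2m). So each residue c
-- allowed for p^k modulo 2m satisfies c² ≡ 1, and for c ≢ 1 the solutions k of p^k ≡ c are u/2 plus
-- multiples of u, if there are any. This is why only u/2, u and 2u can be degrees.

-- The canonical map from ℤ to a commutative ring, and a ring solver with integer coefficients

module IntegerCoefficients {c ℓ} (R : CommutativeRing c ℓ) where
  open CommutativeRing R
  open Algebra.Properties.Ring ring
  open Algebra.Properties.Semiring.Exp semiring public
  open Mult semiring using (×-homo-+; ×1-homo-*) renaming (_×_ to _·_)
  open Relation.Binary.Reasoning.Setoid setoid

  ι : ℤ → Carrier
  ι (+ n) = n · 1#
  ι -[1+ n ] = - (suc n · 1#)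

  ι-neg : ∀ a → ι (ℤ.- a) ≈ - ι a
  ι-neg (+ zero) = sym -0#≈0#
  ι-neg (+ suc n) = refl
  ι-neg -[1+ n ] = sym (-‿involutive _)

  private
    cancel : ∀ x y → (1# + x) - (1# + y) ≈ x - y
    cancel x y = begin
      (1# + x) - (1# + y)      ≈⟨ +-cong (+-comm x 1#) (-‿+-comm 1# y) ⟨
      (x + 1#) + (- 1# - y)    ≈⟨ +-assoc x 1# _ ⟩
      x + (1# + (- 1# - y))    ≈⟨ +-congˡ (+-assoc 1# (- 1#) (- y)) ⟨
      x + ((1# - 1#) - y)      ≈⟨ +-congˡ (+-congʳ (-‿inverseʳ 1#)) ⟩
      x + (0# - y)             ≈⟨ +-congˡ (+-identityˡ _) ⟩
      x - y                    ∎

  ι-⊖ : ∀ m n → ι (m ℤ.⊖ n) ≈ m · 1# - n · 1#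
  ι-⊖ m zero = sym (trans (+-congˡ -0#≈0#) (+-identityʳ _))
  ι-⊖ zero (suc n) = sym (+-identityˡ _)
  ι-⊖ (suc m) (suc n) = begin
    ι (suc m ℤ.⊖ suc n)        ≡⟨ ≡.cong ι (ℤₚ.[1+m]⊖[1+n]≡m⊖n m n) ⟩
    ι (m ℤ.⊖ n)                ≈⟨ ι-⊖ m n ⟩
    m · 1# - n · 1#            ≈⟨ cancel _ _ ⟨
    suc m · 1# - suc n · 1#    ∎

  ι-+ : ∀ a b → ι (a ℤ.+ b) ≈ ι a + ι b
  ι-+ (+ m) (+ n) = ×-homo-+ 1# m n
  ι-+ (+ m) -[1+ n ] = ι-⊖ m (suc n)
  ι-+ -[1+ m ] (+ n) = trans (ι-⊖ n (suc m)) (+-comm _ _)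
  ι-+ -[1+ m ] -[1+ n ] = begin
    - (suc (suc (m ℕ.+ n)) · 1#)        ≡⟨ ≡.cong (λ k → - (k · 1#)) (≡.cong suc (ℕₚ.+-suc m n)) ⟨
    - ((suc m ℕ.+ suc n) · 1#)          ≈⟨ -‿cong (×-homo-+ 1# (suc m) (suc n)) ⟩
    - (suc m · 1# + suc n · 1#)         ≈⟨ -‿+-comm _ _ ⟨
    - (suc m · 1#) - suc n · 1#         ∎

  private
    ι-pos* : ∀ m b → ι (+ m ℤ.* b) ≈ ι (+ m) * ι b
    ι-pos* m (+ n) = trans (reflexive (≡.cong ι (≡.sym (ℤₚ.pos-* m n)))) (×1-homo-* m n)
    ι-pos* m -[1+ n ] = begin
      ι (+ m ℤ.* -[1+ n ])         ≡⟨ ≡.cong ι (ℤₚ.neg-distribʳ-* (+ m) (+ suc n)) ⟨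
      ι (ℤ.- (+ m ℤ.* + suc n))    ≈⟨ ι-neg (+ m ℤ.* + suc n) ⟩
      - ι (+ m ℤ.* + suc n)        ≈⟨ -‿cong (ι-pos* m (+ suc n)) ⟩
      - (ι (+ m) * ι (+ suc n))    ≈⟨ -‿distribʳ-* _ _ ⟩
      ι (+ m) * ι -[1+ n ]         ∎

  ι-* : ∀ a b → ι (a ℤ.* b) ≈ ι a * ι b
  ι-* (+ m) b = ι-pos* m b
  ι-* -[1+ m ] b = begin
    ι (-[1+ m ] ℤ.* b)           ≡⟨ ≡.cong ι (ℤₚ.neg-distribˡ-* (+ suc m) b) ⟨
    ι (ℤ.- (+ suc m ℤ.* b))      ≈⟨ ι-neg (+ suc m ℤ.* b) ⟩
    - ι (+ suc m ℤ.* b)          ≈⟨ -‿cong (ι-pos* (suc m) b) ⟩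
    - (ι (+ suc m) * ι b)        ≈⟨ -‿distribˡ-* _ _ ⟩
    ι -[1+ m ] * ι b             ∎

  -- `ι (+ 1)` unfolds to `1# + 0#`, not to `1#`. Solver calls whose goal mentions `1#` therefore
  -- pass it as a variable, usually `o`.
  ι-1 : ι (+ 1) ≈ 1#
  ι-1 = +-identityʳ 1#

  private
    ℤ-rawRing : RawRing _ _
    ℤ-rawRing = CommutativeRing.rawRing ℤₚ.+-*-commutativeRing

    morphism : ℤ-rawRing -Raw-AlmostCommutative⟶ fromCommutativeRing R
    morphism = record
      { ⟦_⟧ = ι ; +-homo = ι-+ ; *-homo = ι-* ; -‿homo = ι-neg
      ; 0-homo = refl ; 1-homo = ι-1 }

    -- Normal forms are compared through their integer coefficients, so the solver works although
    -- equality in the ring is undecidable.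
    coeff≟ : WeaklyDecidable (Induced-equivalence morphism)
    coeff≟ a b with a ℤₚ.≟ b
    ... | yes eq = just (reflexive (≡.cong ι eq))
    ... | no _ = nothing

  open Algebra.Solver.Ring ℤ-rawRing (fromCommutativeRing R) morphism coeff≟ public
    using (solve; _:=_; _:+_; _:*_; _:-_; :-_; con)

-- Division of integer polynomials by a monic polynomial

-- The division procedure behind divMonic is private to Defs; this copy of it is identified with it in divMonic≡.

subtractMultiple : List ℤ → ℤ → List ℤ → List ℤ
subtractMultiple A c [] = A
subtractMultiple [] c (b ∷ B) = []
subtractMultiple (a ∷ A) c (b ∷ B) = (a ℤ.- c ℤ.* b) ∷ subtractMultiple A c B

tailOrEmpty : List ℤ → List ℤ
tailOrEmpty [] = []
tailOrEmpty (_ ∷ xs) = xs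

quotient : ℕ → List ℤ → List ℤ → List ℤ
quotient zero A B = []
quotient (suc f) [] B = []
quotient (suc f) (a ∷ A) B = a ∷ quotient f (subtractMultiple A a (tailOrEmpty B)) B

-- The underscores stand for the private functions, which cannot be named here;
-- the with-abstractions expose them applied to variables, so that unification finds them.
divMonic≡ : ∀ a b → divMonic a b ≡ reverse (quotient (suc (length a ∸ length b)) (reverse a) (reverse b))
reversed-quotient≡ : ∀ acc f A B → _ ≡ foldl (λ ys y → y ∷ ys) acc (quotient f A B)
subtractMultiple≡ : ∀ A c B → _ ≡ subtractMultiple A c B

divMonic≡ a b with suc (length a ∸ length b) | reverse a | reverse b
... | f | A | B with List.[] {A = ℤ}
...   | acc = reversed-quotient≡ acc f A B
reversed-quotient≡ acc zero A B = ≡.refl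
reversed-quotient≡ acc (suc f) [] B = ≡.refl
reversed-quotient≡ acc (suc f) (a ∷ A) [] = reversed-quotient≡ (a ∷ acc) f A []
reversed-quotient≡ acc (suc f) (a ∷ A) (b ∷ B) =
  ≡.trans (reversed-quotient≡ (a ∷ acc) f _ (b ∷ B))
    (cong (λ z → foldl _ (a ∷ acc) (quotient f z (b ∷ B))) (subtractMultiple≡ A a B))
subtractMultiple≡ A c [] = ≡.refl
subtractMultiple≡ [] c (b ∷ B) = ≡.refl
subtractMultiple≡ (a ∷ A) c (b ∷ B) = cong ((a ℤ.- c ℤ.* b) ∷_) (subtractMultiple≡ A c B)

-- The part of `A` that `quotient` drops. That it vanishes in the divisions defining Φ_d is what has
-- to be shown later.
remainder : ℕ → List ℤ → List ℤ → List ℤ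
remainder zero A B = A
remainder (suc f) [] B = []
remainder (suc f) (a ∷ A) B = remainder f (subtractMultiple A a (tailOrEmpty B)) B

length-subtractMultiple : ∀ A c B → length (subtractMultiple A c B) ≡ length A
length-subtractMultiple A c [] = ≡.refl
length-subtractMultiple [] c (b ∷ B) = ≡.refl
length-subtractMultiple (a ∷ A) c (b ∷ B) = cong suc (length-subtractMultiple A c B)

-- The divisor `b ∷ B` has degree `length B`, so the hypothesis says that the fuel is exactly the
-- number of quotient coefficients.
length-quotient : ∀ f A b B → f ℕ.+ length B ≡ length A → length (quotient f A (b ∷ B)) ≡ f
length-quotient zero A b B eq = ≡.refl
length-quotient (suc f) (a ∷ A) b B eq = cong suc (length-quotient f _ b B
  (≡.trans (ℕₚ.suc-injective eq) (≡.sym (length-subtractMultiple A a B))))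

length-remainder : ∀ f A b B → f ℕ.+ length B ≡ length A → length (remainder f A (b ∷ B)) ≡ length B
length-remainder zero A b B eq = ≡.sym eq
length-remainder (suc f) (a ∷ A) b B eq = length-remainder f _ b B
  (≡.trans (ℕₚ.suc-injective eq) (≡.sym (length-subtractMultiple A a B)))

module Evaluation {c ℓ} (K : CommutativeRing c ℓ) where
  open CommutativeRing K
  open IntegerCoefficients K
  open Relation.Binary.Reasoning.Setoid setoid

  eval : ZPoly → Carrier → Carrier
  eval [] x = 0#
  eval (a ∷ f) x = ι a + x * eval f x

  eval-addP : ∀ f g x → eval (addP f g) x ≈ eval f x + eval g x
  eval-addP [] g x = sym (+-identityˡ _)
  eval-addP (a ∷ f) [] x = sym (+-identityʳ _)
  eval-addP (a ∷ f) (b ∷ g) x = begin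
    ι (a ℤ.+ b) + x * eval (addP f g) x          ≈⟨ +-cong (ι-+ a b) (*-congˡ (eval-addP f g x)) ⟩
    (ι a + ι b) + x * (eval f x + eval g x)
      ≈⟨ solve 5 (λ a b x f g → (a :+ b) :+ x :* (f :+ g) := (a :+ x :* f) :+ (b :+ x :* g)) refl _ _ _ _ _ ⟩
    (ι a + x * eval f x) + (ι b + x * eval g x)  ∎

  eval-scaleP : ∀ a f x → eval (scaleP a f) x ≈ ι a * eval f x
  eval-scaleP a [] x = sym (zeroʳ _)
  eval-scaleP a (b ∷ f) x = begin
    ι (a ℤ.* b) + x * eval (scaleP a f) x   ≈⟨ +-cong (ι-* a b) (*-congˡ (eval-scaleP a f x)) ⟩
    ι a * ι b + x * (ι a * eval f x)
      ≈⟨ solve 4 (λ a b x f → a :* b :+ x :* (a :* f) := a :* (b :+ x :* f)) refl _ _ _ _ ⟩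
    ι a * (ι b + x * eval f x)              ∎

  eval-mulP : ∀ f g x → eval (mulP f g) x ≈ eval f x * eval g x
  eval-mulP [] g x = sym (zeroˡ _)
  eval-mulP (a ∷ f) g x = begin
    eval (addP (scaleP a g) (+ 0 ∷ mulP f g)) x           ≈⟨ eval-addP (scaleP a g) _ x ⟩
    eval (scaleP a g) x + (0# + x * eval (mulP f g) x)
      ≈⟨ +-cong (eval-scaleP a g x) (trans (+-identityˡ _) (*-congˡ (eval-mulP f g x))) ⟩
    ι a * eval g x + x * (eval f x * eval g x)
      ≈⟨ solve 4 (λ a g x f → a :* g :+ x :* (f :* g) := (a :+ x :* f) :* g) refl _ _ _ _ ⟩
    (ι a + x * eval f x) * eval g x                       ∎

  eval-++ : ∀ f g x → eval (f ++ g) x ≈ eval f x + x ^ length f * eval g x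
  eval-++ [] g x = sym (trans (+-identityˡ _) (*-identityˡ _))
  eval-++ (a ∷ f) g x = trans (+-congˡ (*-congˡ (eval-++ f g x)))
    (solve 5 (λ a x f e g → a :+ x :* (f :+ e :* g) := (a :+ x :* f) :+ (x :* e) :* g) refl _ _ _ _ _)

  eval-xn-1 : ∀ n x → eval (xn-1 (suc n)) x ≈ x ^ suc n - 1#
  eval-xn-1 n x = begin
    ι -[1+ 0 ] + x * eval (replicate n (+ 0) ++ + 1 ∷ []) x
      ≈⟨ +-cong (-‿cong ι-1) (*-congˡ (trans (eval-++ (replicate n (+ 0)) _ x)
           (+-cong (eval-zeros n) (*-cong (^-congʳ x (Listₚ.length-replicate n)) (+-cong ι-1 (zeroʳ x)))))) ⟩
    - 1# + x * (0# + x ^ n * (1# + 0#))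
      ≈⟨ solve 3 (λ o x e → (:- o) :+ x :* (con (+ 0) :+ e :* (o :+ con (+ 0))) := x :* (e :* o) :- o) refl _ _ _ ⟩
    x * (x ^ n * 1#) - 1#
      ≈⟨ +-congʳ (*-congˡ (*-identityʳ _)) ⟩
    x ^ suc n - 1#  ∎
    where
    eval-zeros : ∀ n → eval (replicate n (+ 0)) x ≈ 0#
    eval-zeros zero = refl
    eval-zeros (suc n) = trans (+-identityˡ _) (trans (*-congˡ (eval-zeros n)) (zeroʳ x))

  evalHF : List ℤ → Carrier → Carrier
  evalHF A = eval (reverse A)

  evalHF-∷ : ∀ a A x → evalHF (a ∷ A) x ≈ evalHF A x + x ^ length A * ι a
  evalHF-∷ a A x = begin
    eval (reverse (a ∷ A)) x       ≡⟨ cong (λ f → eval f x) (Listₚ.unfold-reverse a A) ⟩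
    eval (reverse A ++ a ∷ []) x   ≈⟨ eval-++ (reverse A) (a ∷ []) x ⟩
    evalHF A x + x ^ length (reverse A) * (ι a + x * 0#)
      ≈⟨ +-congˡ (*-cong (^-congʳ x (Listₚ.length-reverse A)) (trans (+-congˡ (zeroʳ x)) (+-identityʳ _))) ⟩
    evalHF A x + x ^ length A * ι a ∎

  -- The lists are aligned at their highest coefficients, so subtracting `c` times `B` entrywise
  -- subtracts c x^k B(x), where `k` is the excess length of `A`.
  evalHF-subtractMultiple : ∀ k A c B x → length A ≡ k ℕ.+ length B →
    evalHF (subtractMultiple A c B) x ≈ evalHF A x - ι c * x ^ k * evalHF B x
  evalHF-subtractMultiple k A c [] x eq =
    solve 2 (λ A d → A := A :- d :* con (+ 0)) refl _ (ι c * x ^ k)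
  evalHF-subtractMultiple k [] c (b ∷ B) x eq with ≡.trans eq (ℕₚ.+-suc k (length B))
  ... | ()
  evalHF-subtractMultiple k (a ∷ A) c (b ∷ B) x eq = begin
    evalHF ((a ℤ.- c ℤ.* b) ∷ subtractMultiple A c B) x
      ≈⟨ evalHF-∷ _ (subtractMultiple A c B) x ⟩
    evalHF (subtractMultiple A c B) x + x ^ length (subtractMultiple A c B) * ι (a ℤ.- c ℤ.* b)
      ≈⟨ +-cong (evalHF-subtractMultiple k A c B x eq′)
           (*-cong (trans (^-congʳ x (≡.trans (length-subtractMultiple A c B) eq′)) (^-homo-* x k (length B)))
             (trans (ι-+ a _) (+-congˡ (trans (ι-neg (c ℤ.* b)) (-‿cong (ι-* c b)))))) ⟩
    (evalHF A x - ι c * x ^ k * evalHF B x) + x ^ k * x ^ length B * (ι a - ι c * ι b)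
      ≈⟨ solve 7 (λ A c k B l a b → (A :- c :* k :* B) :+ k :* l :* (a :- c :* b)
           := (A :+ k :* l :* a) :- c :* k :* (B :+ l :* b)) refl
           (evalHF A x) (ι c) (x ^ k) (evalHF B x) (x ^ length B) (ι a) (ι b) ⟩
    (evalHF A x + x ^ k * x ^ length B * ι a) - ι c * x ^ k * (evalHF B x + x ^ length B * ι b)
      ≈⟨ +-cong (trans (evalHF-∷ a A x) (+-congˡ (*-congʳ (trans (^-congʳ x eq′) (^-homo-* x k (length B))))))
           (-‿cong (*-congˡ (evalHF-∷ b B x))) ⟨
    evalHF (a ∷ A) x - ι c * x ^ k * evalHF (b ∷ B) x ∎
    where
    eq′ : length A ≡ k ℕ.+ length B
    eq′ = ℕₚ.suc-injective (≡.trans eq (ℕₚ.+-suc k (length B)))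

  -- Because the divisor is monic, a x^f times it cancels the leading term of `a ∷ A`. Each round
  -- moves a x^f into the quotient and leaves `A′`.
  evalHF-division : ∀ f A B x → f ℕ.+ length B ≡ length A →
    evalHF A x ≈ evalHF (quotient f A (+ 1 ∷ B)) x * evalHF (+ 1 ∷ B) x + evalHF (remainder f A (+ 1 ∷ B)) x
  evalHF-division zero A B x eq = sym (trans (+-congʳ (zeroˡ _)) (+-identityˡ _))
  evalHF-division (suc f) (a ∷ A) B x eq = begin
    evalHF (a ∷ A) x
      ≈⟨ evalHF-∷ a A x ⟩
    evalHF A x + x ^ length A * ι a
      ≈⟨ +-congˡ (*-congʳ (trans (^-congʳ x (≡.sym eq₁)) (^-homo-* x f (length B)))) ⟩
    evalHF A x + xᶠ * x ^ length B * ι a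
      ≈⟨ solve 5 (λ A xᶠ l a B → A :+ xᶠ :* l :* a
           := xᶠ :* a :* (B :+ l) :+ (A :- a :* xᶠ :* B)) refl
           (evalHF A x) xᶠ (x ^ length B) (ι a) (evalHF B x) ⟩
    xᶠ * ι a * (evalHF B x + x ^ length B) + (evalHF A x - ι a * xᶠ * evalHF B x)
      ≈⟨ +-cong (*-congˡ (sym (trans (evalHF-∷ (+ 1) B x) (+-congˡ (trans (*-congˡ ι-1) (*-identityʳ _))))))
           (sym (evalHF-subtractMultiple f A a B x (≡.sym eq₁))) ⟩
    xᶠ * ι a * evalHF (+ 1 ∷ B) x + evalHF A′ x
      ≈⟨ +-congˡ (evalHF-division f A′ B x eq₂) ⟩
    xᶠ * ι a * evalHF (+ 1 ∷ B) x + (evalHF Q x * evalHF (+ 1 ∷ B) x + evalHF (remainder f A′ (+ 1 ∷ B)) x)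
      ≈⟨ solve 5 (λ xᶠ a D Q R → xᶠ :* a :* D :+ (Q :* D :+ R) := (Q :+ xᶠ :* a) :* D :+ R) refl _ _ _ _ _ ⟩
    (evalHF Q x + xᶠ * ι a) * evalHF (+ 1 ∷ B) x + evalHF (remainder f A′ (+ 1 ∷ B)) x
      ≈⟨ +-congʳ (*-congʳ (trans (evalHF-∷ a Q x) (+-congˡ (*-congʳ (^-congʳ x (length-quotient f A′ (+ 1) B eq₂)))))) ⟨
    evalHF (a ∷ Q) x * evalHF (+ 1 ∷ B) x + evalHF (remainder f A′ (+ 1 ∷ B)) x ∎
    where
    xᶠ = x ^ f
    A′ = subtractMultiple A a B
    Q = quotient f A′ (+ 1 ∷ B)
    eq₁ : f ℕ.+ length B ≡ length A
    eq₁ = ℕₚ.suc-injective eq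
    eq₂ : f ℕ.+ length B ≡ length A′
    eq₂ = ≡.trans eq₁ (≡.sym (length-subtractMultiple A a B))

-- With a literal `+ 1` at the end, the reversed list starts with `+ 1`, as the division requires,
-- and the degree stays `d` in every ring.
Monic : ℕ → ZPoly → Set
Monic d f = ∃ λ g → length g ≡ d × f ≡ g ++ + 1 ∷ []

Monic-1 : Monic 0 (+ 1 ∷ [])
Monic-1 = [] , ≡.refl , ≡.refl

Monic-xn-1 : ∀ n → Monic (suc n) (xn-1 (suc n))
Monic-xn-1 n = -[1+ 0 ] ∷ replicate n (+ 0) , cong suc (Listₚ.length-replicate n) , ≡.refl

addP-identityʳ : ∀ f → addP f [] ≡ f
addP-identityʳ [] = ≡.refl
addP-identityʳ (_ ∷ _) = ≡.refl

Monic-addP : ∀ f {d g} → length f ≤ d → Monic d g → Monic d (addP f g)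
Monic-addP [] _ mg = mg
Monic-addP (a ∷ f) (s≤s l) (b ∷ h , ≡.refl , ≡.refl) with Monic-addP f l (h , ≡.refl , ≡.refl)
... | k , eq , eq′ = (a ℤ.+ b) ∷ k , cong suc eq , cong (_ ∷_) eq′

Monic-mulP : ∀ {d e f g} → Monic d f → Monic e g → Monic (d ℕ.+ e) (mulP f g)
Monic-mulP {g = g} (h , ≡.refl , ≡.refl) mg@(k , eq , eq′) = go h
  where
  monic-length : length g ≡ suc (length k)
  monic-length = ≡.trans (cong length eq′) (≡.trans (Listₚ.length-++ k) (ℕₚ.+-comm _ 1))
  1*-identity : ∀ f → scaleP (+ 1) f ≡ f
  1*-identity [] = ≡.refl
  1*-identity (a ∷ f) = ≡.cong₂ _∷_ (ℤₚ.*-identityˡ a) (1*-identity f)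
  -- This fails for the empty list, which padding by `+ 0` lengthens; monicity excludes it.
  +0-identity : ∀ {d} f → Monic d f → addP f (+ 0 ∷ []) ≡ f
  +0-identity [] ([] , _ , ())
  +0-identity [] (_ ∷ _ , _ , ())
  +0-identity (a ∷ f) _ = ≡.cong₂ _∷_ (ℤₚ.+-identityʳ a) (addP-identityʳ f)
  go : ∀ h → Monic (length h ℕ.+ _) (mulP (h ++ + 1 ∷ []) g)
  go [] = subst (Monic _) (≡.sym (≡.trans (cong (λ f → addP f (+ 0 ∷ [])) (1*-identity g)) (+0-identity g mg))) mg
  go (a ∷ h) with go h
  ... | l , eqₗ , eqₗ′ = Monic-addP (scaleP a g) length≤ (+ 0 ∷ l , cong suc eqₗ , cong (+ 0 ∷_) eqₗ′)
    where
    length≤ : length (scaleP a g) ≤ suc (length h ℕ.+ _)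
    length≤ = ℕₚ.≤-trans (ℕₚ.≤-reflexive (≡.trans (Listₚ.length-map (a ℤ.*_) g) monic-length))
      (s≤s (ℕₚ.≤-trans (ℕₚ.≤-reflexive eq) (ℕₚ.m≤n+m _ (length h))))

module _ {d e a b} (ma : Monic d a) (mb : Monic e b) (e≤d : e ≤ d) where
  private
    g = proj₁ ma
    h = proj₁ mb
    f = suc (length a ∸ length b)
    A = reverse a
    B = reverse h

    reverse-monic : ∀ {d a} ((g , _) : Monic d a) → reverse a ≡ + 1 ∷ reverse g
    reverse-monic (g , _ , ≡.refl) = Listₚ.reverse-++ g (+ 1 ∷ [])

    length-monic : ∀ {d a} → Monic d a → length a ≡ suc d
    length-monic (g , ≡.refl , ≡.refl) = ≡.trans (Listₚ.length-++ g) (ℕₚ.+-comm _ 1)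

    f≡ : f ≡ suc (d ∸ e)
    f≡ = cong suc (≡.cong₂ _∸_ (length-monic ma) (length-monic mb))

    fuel : f ℕ.+ length B ≡ length A
    fuel = begin
      f ℕ.+ length B           ≡⟨ ≡.cong₂ ℕ._+_ f≡ (≡.trans (Listₚ.length-reverse h) (proj₁ (proj₂ mb))) ⟩
      suc (d ∸ e) ℕ.+ e        ≡⟨ cong suc (ℕₚ.m∸n+n≡m e≤d) ⟩
      suc d                    ≡⟨ length-monic ma ⟨
      length a                 ≡⟨ Listₚ.length-reverse a ⟨
      length A                 ∎
      where open ≡-Reasoning

    divMonic≡′ : divMonic a b ≡ reverse (quotient f A (+ 1 ∷ B))
    divMonic≡′ = ≡.trans (divMonic≡ a b) (cong (λ B → reverse (quotient f A B)) (reverse-monic mb))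

  -- The first quotient coefficient is the leading coefficient of `a`, which is `+ 1`; reversing the
  -- list puts it at the end.
  Monic-divMonic : Monic (d ∸ e) (divMonic a b)
  Monic-divMonic = subst (Monic _) (≡.sym divMonic≡′) (go (reverse-monic ma) fuel)
    where
    go : ∀ {A G} → A ≡ + 1 ∷ G → f ℕ.+ length B ≡ length A → Monic (d ∸ e) (reverse (quotient f A (+ 1 ∷ B)))
    go {G = G} ≡.refl eq = reverse Q
      , ≡.trans (Listₚ.length-reverse Q)
          (ℕₚ.suc-injective (≡.trans (length-quotient f (+ 1 ∷ G) (+ 1) B eq) f≡))
      , Listₚ.unfold-reverse (+ 1) Q
      where Q = quotient (length a ∸ length b) (subtractMultiple G (+ 1) B) (+ 1 ∷ B)

  divMonic-remainder : ZPoly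
  divMonic-remainder = reverse (remainder f A (+ 1 ∷ B))

  length-divMonic-remainder : length divMonic-remainder ≡ e
  length-divMonic-remainder = ≡.trans (Listₚ.length-reverse (remainder f A (+ 1 ∷ B)))
    (≡.trans (length-remainder f A (+ 1) B fuel) (≡.trans (Listₚ.length-reverse h) (proj₁ (proj₂ mb))))

  module _ {c ℓ} (K : CommutativeRing c ℓ) where
    open CommutativeRing K
    open Evaluation K
    open Relation.Binary.Reasoning.Setoid setoid

    -- The ring is arbitrary because the identity serves twice: in the field, to find roots of the
    -- remainder, and in the dual numbers, once the remainder is known to vanish.
    eval-divMonic : ∀ x → eval a x ≈ eval (divMonic a b) x * eval b x + eval divMonic-remainder x
    eval-divMonic x = begin
      eval a x                  ≡⟨ cong (λ f → eval f x) (Listₚ.reverse-involutive a) ⟨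
      evalHF A x                ≈⟨ evalHF-division f A B x fuel ⟩
      evalHF (quotient f A (+ 1 ∷ B)) x * evalHF (+ 1 ∷ B) x + eval divMonic-remainder x
        ≡⟨ ≡.cong₂ (λ q b → eval q x * eval b x + eval divMonic-remainder x) divMonic≡′
             (≡.trans (≡.sym (Listₚ.reverse-involutive b)) (cong reverse (reverse-monic mb))) ⟨
      eval (divMonic a b) x * eval b x + eval divMonic-remainder x ∎

-- Dual numbers, roots and multiplicities

module DualNumbers {c ℓ} (R : CommutativeRing c ℓ) where
  private
    open module R = CommutativeRing R
    open IntegerCoefficients R
    module A×A = AbelianGroup (DirectProduct.abelianGroup R.+-abelianGroup R.+-abelianGroup)

  -- A pair (a, a′) stands for a + a′ε with ε² = 0. The value of a polynomial at `a +ε` consists of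
  -- its value and its derivative at a.
  Dual : Set c
  Dual = Carrier × Carrier

  infixl 7 _*ᵈ_
  _*ᵈ_ : Dual → Dual → Dual
  (a , a′) *ᵈ (b , b′) = a * b , a * b′ + a′ * b

  dualRing : CommutativeRing c ℓ
  dualRing = record
    { Carrier = Dual
    ; _≈_ = A×A._≈_
    ; _+_ = A×A._∙_
    ; _*_ = _*ᵈ_
    ; -_ = A×A._⁻¹
    ; 0# = A×A.ε
    ; 1# = 1# , 0#
    ; isCommutativeRing = record
      { isRing = record
        { +-isAbelianGroup = A×A.isAbelianGroup
        ; *-cong = λ { (p , p′) (q , q′) → *-cong p q , +-cong (*-cong p q′) (*-cong p′ q) }
        ; *-assoc = λ { (a , a′) (b , b′) (d , d′) → *-assoc a b d ,
            solve 6 (λ a a′ b b′ d d′ → (a :* b) :* d′ :+ (a :* b′ :+ a′ :* b) :* d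
              := a :* (b :* d′ :+ b′ :* d) :+ a′ :* (b :* d)) refl a a′ b b′ d d′ }
        ; *-identity =
            (λ { (a , a′) → *-identityˡ a , trans (+-cong (*-identityˡ a′) (zeroˡ a)) (+-identityʳ a′) }) ,
            (λ { (a , a′) → *-identityʳ a , trans (+-cong (zeroʳ a) (*-identityʳ a′)) (+-identityˡ a′) })
        ; distrib =
            (λ { (a , a′) (b , b′) (d , d′) → distribˡ a b d ,
              solve 6 (λ a a′ b b′ d d′ → a :* (b′ :+ d′) :+ a′ :* (b :+ d)
                := (a :* b′ :+ a′ :* b) :+ (a :* d′ :+ a′ :* d)) refl a a′ b b′ d d′ }) ,
            (λ { (a , a′) (b , b′) (d , d′) → distribʳ a b d ,
              solve 6 (λ a a′ b b′ d d′ → (b :+ d) :* a′ :+ (b′ :+ d′) :* a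
                := (b :* a′ :+ b′ :* a) :+ (d :* a′ :+ d′ :* a)) refl a a′ b b′ d d′ })
        }
      ; *-comm = λ { (a , a′) (b , b′) → *-comm a b ,
          solve 4 (λ a a′ b b′ → a :* b′ :+ a′ :* b := b :* a′ :+ b′ :* a) refl a a′ b b′ }
      }
    }

  private
    module D = CommutativeRing dualRing
    module Dᶻ = IntegerCoefficients dualRing

  infix 10 _+ε
  _+ε : Carrier → Dual
  a +ε = a , 1#

  ι-dual : ∀ n → Dᶻ.ι n D.≈ (ι n , 0#)
  ι-dual (+ n) = ×-dual n
    where
    ×-dual : ∀ n → Dᶻ.ι (+ n) D.≈ (ι (+ n) , 0#)
    ×-dual zero = D.refl
    ×-dual (suc n) = +-congˡ (proj₁ (×-dual n)) , trans (+-identityˡ _) (proj₂ (×-dual n))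
  ι-dual -[1+ n ] = D.trans (D.-‿cong (ι-dual (+ suc n))) (refl , solve 0 (:- con (+ 0) := con (+ 0)) refl)

  ^-dual : ∀ a n → (a +ε) Dᶻ.^ suc n D.≈ (a ^ suc n , ι (+ suc n) * a ^ n)
  ^-dual a zero = refl ,
    trans (+-congʳ (zeroʳ a)) (trans (+-identityˡ _) (sym (*-congʳ ι-1)))
  ^-dual a (suc n) = D.trans (D.*-congˡ {a +ε} (^-dual a n)) (refl ,
    solve 4 (λ a i e o → a :* (i :* e) :+ o :* (a :* e) := (o :+ i) :* (a :* e)) refl a (ι (+ suc n)) (a ^ n) 1#)

module FieldTheory {c ℓ} (F : Field c ℓ) where
  open Field F
  open FieldOps F
  open IntegerCoefficients commutativeRing public
  open DualNumbers commutativeRing public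
  open Relation.Binary.Reasoning.Setoid setoid
  private
    module D = CommutativeRing dualRing
    module Dᶻ = IntegerCoefficients dualRing

  *-cancel-0 : ∀ {x y} → x ≉ 0# → x * y ≈ 0# → y ≈ 0#
  *-cancel-0 {x} {y} x≉0 xy≈0 = begin
    y                ≈⟨ *-identityˡ y ⟨
    1# * y           ≈⟨ *-congʳ (inverse x x≉0) ⟨
    (x ⁻¹ * x) * y   ≈⟨ *-assoc _ _ _ ⟩
    x ⁻¹ * (x * y)   ≈⟨ *-congˡ xy≈0 ⟩
    x ⁻¹ * 0#        ≈⟨ zeroʳ _ ⟩
    0#               ∎

  no-zero-divisors : ∀ {x y} → x * y ≈ 0# → ¬ ¬ (x ≈ 0# ⊎ y ≈ 0#)
  no-zero-divisors xy≈0 k = k (inj₂ (*-cancel-0 (λ x≈0 → k (inj₁ x≈0)) xy≈0))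

  x-y≈0⇒x≈y : ∀ {x y} → x - y ≈ 0# → x ≈ y
  x-y≈0⇒x≈y {x} {y} eq = begin
    x            ≈⟨ solve 2 (λ x y → x := (x :- y) :+ y) refl x y ⟩
    (x - y) + y  ≈⟨ +-congʳ eq ⟩
    0# + y       ≈⟨ +-identityˡ y ⟩
    y            ∎

  x≈y⇒x-y≈0 : ∀ {x y} → x ≈ y → x - y ≈ 0#
  x≈y⇒x-y≈0 eq = trans (+-congʳ eq) (-‿inverseʳ _)

  ^-≉0 : ∀ {x} n → x ≉ 0# → x ^ n ≉ 0#
  ^-≉0 zero x≉0 = 1≉0
  ^-≉0 (suc n) x≉0 eq = ^-≉0 n x≉0 (*-cancel-0 x≉0 eq)

  1^n≈1 : ∀ n → 1# ^ n ≈ 1#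
  1^n≈1 zero = refl
  1^n≈1 (suc n) = trans (*-identityˡ _) (1^n≈1 n)

  pow≈^ : ∀ x n → pow x n ≡ x ^ n
  pow≈^ x zero = ≡.refl
  pow≈^ x (suc n) = cong (x *_) (pow≈^ x n)

  fromℕ≡ι : ∀ n → fromℕ n ≡ ι (+ n)
  fromℕ≡ι zero = ≡.refl
  fromℕ≡ι (suc n) = cong (λ y → 1# + y) (fromℕ≡ι n)

  evalVec : ∀ {n} → Vec Carrier n → Carrier → Carrier
  evalVec [] x = 0#
  evalVec (a ∷ f) x = a + x * evalVec f x

  evalVec-∷ʳ1 : ∀ {n} (f : Vec Carrier n) x → evalVec (f ∷ʳ 1#) x ≈ evalMonic f x
  evalVec-∷ʳ1 [] x = trans (+-congˡ (zeroʳ x)) (+-identityʳ 1#)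
  evalVec-∷ʳ1 (a ∷ f) x = +-congˡ (*-congˡ (evalVec-∷ʳ1 f x))

  -- Horner's scheme: the coefficients of (f(x) - f(a)) / (x - a) are the values at `a` of the
  -- successive tails of `f`.
  quotientByRoot : ∀ {n} → Carrier → Vec Carrier (suc n) → Vec Carrier n
  quotientByRoot a (_ ∷ []) = []
  quotientByRoot a (_ ∷ f@(_ ∷ _)) = evalVec f a ∷ quotientByRoot a f

  evalVec-quotient : ∀ {n} a (f : Vec Carrier (suc n)) x →
    evalVec f x ≈ evalVec f a + (x - a) * evalVec (quotientByRoot a f) x
  evalVec-quotient a (b ∷ []) x =
    solve 3 (λ a b x → b :+ x :* con (+ 0) := (b :+ a :* con (+ 0)) :+ (x :- a) :* con (+ 0)) refl a b x
  evalVec-quotient a (b ∷ f@(_ ∷ _)) x = trans (+-congˡ (*-congˡ (evalVec-quotient a f x)))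
    (solve 5 (λ a b x fa q → b :+ x :* (fa :+ (x :- a) :* q)
      := (b :+ a :* fa) :+ (x :- a) :* (fa :+ x :* q)) refl a b x _ _)

  zero-of-quotient : ∀ {n} a (f : Vec Carrier (suc n)) → VecAll.All (_≈ 0#) (quotientByRoot a f) →
    evalVec f a ≈ 0# → VecAll.All (_≈ 0#) f
  zero-of-quotient a (b ∷ []) _ eq = trans (sym (trans (+-congˡ (zeroʳ a)) (+-identityʳ b))) eq ∷ []
  zero-of-quotient a (b ∷ f@(_ ∷ _)) (fa≈0 ∷ qs) eq =
    trans (sym (trans (+-congˡ (trans (*-congˡ fa≈0) (zeroʳ a))) (+-identityʳ b))) eq ∷ zero-of-quotient a f qs fa≈0

  -- Division by x - a keeps the other roots because they differ from a. The conclusion concerns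
  -- coefficients rather than values, so that it carries over to evaluation at dual numbers.
  too-many-roots : ∀ {n} (f : Vec Carrier n) as → n ≤ length as → AllPairs _≉_ as →
    All (λ a → evalVec f a ≈ 0#) as → VecAll.All (_≈ 0#) f
  too-many-roots [] as _ _ _ = []
  too-many-roots f@(_ ∷ _) (a ∷ as) (s≤s n≤) (a≉ ∷ distinct) (fa≈0 ∷ roots) =
    zero-of-quotient a f (too-many-roots (quotientByRoot a f) as n≤ distinct
      (All.zipWith (λ (a≉b , fb≈0) → *-cancel-0 (λ b-a≈0 → a≉b (sym (x-y≈0⇒x≈y b-a≈0)))
        (trans (sym (trans (+-congʳ fa≈0) (+-identityˡ _))) (trans (sym (evalVec-quotient a f _)) fb≈0))) (a≉ , roots)))
      fa≈0

  too-many-roots-monic : ∀ {n} (f : Vec Carrier n) as → n ℕ.< length as → AllPairs _≉_ as →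
    ¬ All (λ a → evalMonic f a ≈ 0#) as
  too-many-roots-monic f as n< distinct roots = 1≉0 (last≈0 f
    (too-many-roots (f ∷ʳ 1#) as n< distinct (All.map (trans (evalVec-∷ʳ1 f _)) roots)))
    where
    last≈0 : ∀ {n} (f : Vec Carrier n) → VecAll.All (_≈ 0#) (f ∷ʳ 1#) → 1# ≈ 0#
    last≈0 [] (eq ∷ []) = eq
    last≈0 (_ ∷ f) (_ ∷ eqs) = last≈0 f eqs

  evalMonic+ε : ∀ {n} → Vec Carrier n → Carrier → Dual
  evalMonic+ε [] x = D.1#
  evalMonic+ε (a ∷ f) x = (a , 0#) D.+ (x +ε) D.* evalMonic+ε f x

  evalMonic+ε-proj₁ : ∀ {n} (f : Vec Carrier n) x → proj₁ (evalMonic+ε f x) ≈ evalMonic f x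
  evalMonic+ε-proj₁ [] x = refl
  evalMonic+ε-proj₁ (a ∷ f) x = +-congˡ (*-congˡ (evalMonic+ε-proj₁ f x))

  monicQuotient : ∀ {n} → Carrier → Vec Carrier (suc n) → Vec Carrier n
  monicQuotient a (_ ∷ []) = []
  monicQuotient a (_ ∷ f@(_ ∷ _)) = evalMonic f a ∷ monicQuotient a f

  evalMonic+ε-quotient : ∀ {n} a (f : Vec Carrier (suc n)) x →
    evalMonic+ε f x D.≈ (evalMonic f a , 0#) D.+ ((x +ε) D.- (a , 0#)) D.* evalMonic+ε (monicQuotient a f) x
  evalMonic+ε-quotient a (b ∷ []) x =
    solve 4 (λ a b x o → b :+ x :* o := (b :+ a :* o) :+ (x :- a) :* o) refl a b x 1# ,
    solve 3 (λ a x o → con (+ 0) :+ (x :* con (+ 0) :+ o :* o)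
      := con (+ 0) :+ ((x :- a) :* con (+ 0) :+ (o :- con (+ 0)) :* o)) refl a x 1#
  evalMonic+ε-quotient a (b ∷ f@(_ ∷ _)) x = D.trans
    (D.+-congˡ {b , 0#} (D.*-congˡ {x +ε} (evalMonic+ε-quotient a f x)))
    (solve 5 (λ a b x fa q → b :+ x :* (fa :+ (x :- a) :* q)
      := (b :+ a :* fa) :+ (x :- a) :* (fa :+ x :* q)) refl a b x _ _ ,
     solve 6 (λ a x fa q q′ o →
       con (+ 0) :+ (x :* (con (+ 0) :+ ((x :- a) :* q′ :+ (o :- con (+ 0)) :* q)) :+ o :* (fa :+ (x :- a) :* q))
       := con (+ 0) :+ ((x :- a) :* (con (+ 0) :+ (x :* q′ :+ o :* q)) :+ (o :- con (+ 0)) :* (fa :+ x :* q)))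
       refl a x (evalMonic f a) _ _ 1#)

  -- If `u` and `v` are both multiples of ε, their product is 0. Its two components then read
  -- a^(n+1) = 1 and (n + 1) a^n = 0, which are incompatible when n + 1 ≠ 0.
  no-double-root : ∀ n a → ι (+ suc n) ≉ 0# → ∀ u v →
    u D.* v D.≈ (a +ε) Dᶻ.^ suc n D.- D.1# → proj₁ u ≈ 0# → ¬ (proj₁ v ≈ 0#)
  no-double-root n a n≉0 u v eq u≈0 v≈0 = 1≉0 (begin
    1#           ≈⟨ x-y≈0⇒x≈y (trans (sym (proj₁ eq′)) (trans (*-congʳ u≈0) (zeroˡ _))) ⟨
    a * a ^ n    ≈⟨ *-congˡ aⁿ≈0 ⟩
    a * 0#       ≈⟨ zeroʳ a ⟩
    0#           ∎)
    where
    eq′ = D.trans eq (D.+-congʳ { D.- D.1#} (^-dual a n))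
    aⁿ≈0 : a ^ n ≈ 0#
    aⁿ≈0 = *-cancel-0 n≉0 (begin
      ι (+ suc n) * a ^ n                  ≈⟨ solve 1 (λ y → y := y :- con (+ 0)) refl _ ⟩
      ι (+ suc n) * a ^ n - 0#             ≈⟨ proj₂ eq′ ⟨
      proj₁ u * proj₂ v + proj₂ u * proj₁ v ≈⟨ +-cong (*-congʳ u≈0) (*-congˡ v≈0) ⟩
      0# * proj₂ v + proj₂ u * 0#          ≈⟨ +-cong (zeroˡ _) (zeroʳ _) ⟩
      0# + 0#                              ≈⟨ +-identityˡ 0# ⟩
      0#                                   ∎)

  DistinctRoots : (Carrier → Carrier) → ℕ → Set _
  DistinctRoots f k = ∃ λ as → length as ≡ k × AllPairs _≉_ as × All (λ a → f a ≈ 0#) as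

  -- Algebraic closedness supplies a root `a` of `f`. It is not a root of the quotient `g`, since x
  -- - a would then divide x^(n+1) - 1 twice. The cofactor `h` is a mere function on points, which
  -- lets it absorb x - a when `f` is replaced by `g`.
  divisor-of-xn-1-splits : AlgClosed → ∀ n → ι (+ suc n) ≉ 0# →
    ∀ {k} (f : Vec Carrier k) (h : Carrier → Dual) →
    (∀ x → evalMonic+ε f x D.* h x D.≈ (x +ε) Dᶻ.^ suc n D.- D.1#) → DistinctRoots (evalMonic f) k
  divisor-of-xn-1-splits closed n n≉0 [] h eq = [] , ≡.refl , [] , []
  divisor-of-xn-1-splits closed n n≉0 {suc k} f h eq =
    let as , len , distinct , roots = divisor-of-xn-1-splits closed n n≉0 g h′ eq′
    in a ∷ as , cong suc len , All.map (λ gb≈0 a≈b → a-not-root-of-g a≈b gb≈0) roots ∷ distinct ,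
       fa≈0 ∷ All.map (λ gb≈0 → trans (f≈ _) (trans (*-congˡ gb≈0) (zeroʳ _))) roots
    where
    a = proj₁ (closed k f)
    fa≈0 = proj₂ (closed k f)
    g = monicQuotient a f
    x-a : Carrier → Dual
    x-a x = (x +ε) D.- (a , 0#)
    factor : ∀ x → evalMonic+ε f x D.≈ x-a x D.* evalMonic+ε g x
    factor x = D.trans (evalMonic+ε-quotient a f x)
      (D.trans (D.+-congʳ {x-a x D.* evalMonic+ε g x} (fa≈0 , refl)) (D.+-identityˡ _))
    f≈ : ∀ x → evalMonic f x ≈ (x - a) * evalMonic g x
    f≈ x = trans (sym (evalMonic+ε-proj₁ f x)) (trans (proj₁ (factor x)) (*-congˡ (evalMonic+ε-proj₁ g x)))
    h′ : Carrier → Dual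
    h′ x = x-a x D.* h x
    eq′ : ∀ x → evalMonic+ε g x D.* h′ x D.≈ (x +ε) Dᶻ.^ suc n D.- D.1#
    eq′ x = D.trans (D.trans (D.sym (D.*-assoc (evalMonic+ε g x) (x-a x) (h x)))
      (D.*-congʳ {h x} (D.trans (D.*-comm (evalMonic+ε g x) (x-a x)) (D.sym (factor x))))) (eq x)
    a-not-root-of-g : ∀ {b} → a ≈ b → ¬ (evalMonic g b ≈ 0#)
    a-not-root-of-g {b} a≈b gb≈0 = no-double-root n b n≉0 (evalMonic+ε g b) (h′ b) (eq′ b)
      (trans (evalMonic+ε-proj₁ g b) gb≈0)
      (trans (*-congʳ (x≈y⇒x-y≈0 (sym a≈b))) (zeroˡ _))

-- Roots of cyclotomic polynomials

-- The filter repeats the one in `cyclotomic`, which makes `cyclotomic d` definitionally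
-- `divMonic (xn-1 d) (properProduct d)` for d ≥ 1.
properDivisors : ℕ → List (ℕ × ZPoly)
properDivisors zero = []
properDivisors (suc n) = filter (λ dp → proj₁ dp ∣? suc n) (cycTable n)

properProduct : ℕ → ZPoly
properProduct d = prodP (map proj₂ (properDivisors d))

table-entries : ∀ n → All (λ (e , f) → 1 ≤ e × e ≤ n × f ≡ cyclotomic e) (cycTable n)
table-entries zero = []
table-entries (suc n) = Allₚ.++⁺ (All.map (λ (l , l′ , eq) → l , ℕₚ.m≤n⇒m≤1+n l′ , eq) (table-entries n))
  ((s≤s z≤n , ℕₚ.≤-refl , ≡.refl) ∷ [])

-- Increasing indices keep the roots of different entries apart: a common root would satisfy a^e = 1
-- for the smaller index e, below its exact order.
table-sorted : ∀ n → AllPairs (λ x y → proj₁ x < proj₁ y) (cycTable n)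
table-sorted zero = []
table-sorted (suc n) = AllPairsₚ.++⁺ (table-sorted n) ([] ∷ [])
  (All.map (λ (_ , l , _) → s≤s l ∷ []) (table-entries n))

table-complete : ∀ {e} n → 1 ≤ e → e ≤ n → (e , cyclotomic e) ∈ cycTable n
table-complete zero (s≤s _) ()
table-complete {e} (suc n) 1≤e e≤ with e ℕₚ.≟ suc n
... | yes ≡.refl = ∈-++⁺ʳ (cycTable n) (here ≡.refl)
... | no e≢ = ∈-++⁺ˡ (table-complete n 1≤e (ℕ.s≤s⁻¹ (ℕₚ.≤∧≢⇒< e≤ e≢)))

properDivisors-entries : ∀ d → All (λ (e , f) → 1 ≤ e × e < d × e ∣ d × f ≡ cyclotomic e) (properDivisors d)
properDivisors-entries zero = []
properDivisors-entries (suc n) = All.zipWith (λ ((l , l′ , eq) , e∣) → l , s≤s l′ , e∣ , eq)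
  (Allₚ.filter⁺ (λ dp → proj₁ dp ∣? suc n) (table-entries n) ,
   Allₚ.all-filter (λ dp → proj₁ dp ∣? suc n) (cycTable n))

properDivisors-sorted : ∀ d → AllPairs (λ x y → proj₁ x < proj₁ y) (properDivisors d)
properDivisors-sorted zero = []
properDivisors-sorted (suc n) = AllPairsₚ.filter⁺ (λ dp → proj₁ dp ∣? suc n) (table-sorted n)

properDivisors-complete : ∀ {e d} → 1 ≤ e → e < d → e ∣ d → (e , cyclotomic e) ∈ properDivisors d
properDivisors-complete {d = suc n} 1≤e (s≤s e≤n) e∣d =
  ∈-filter⁺ (λ dp → proj₁ dp ∣? suc n) (table-complete n 1≤e e≤n) e∣d

module CyclotomicRoots {c ℓ} (F : Field c ℓ) (closed : FieldOps.AlgClosed F) where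
  open Field F
  open FieldOps F
  open FieldTheory F
  open Evaluation commutativeRing public using (eval; eval-mulP; eval-xn-1)
  private
    module D = CommutativeRing dualRing
    module Dᶻ = IntegerCoefficients dualRing
    module Dᵉ = Evaluation dualRing

  fromℤ≡ι : ∀ a → fromℤ a ≡ ι a
  fromℤ≡ι (+ n) = fromℕ≡ι n
  fromℤ≡ι -[1+ n ] = cong (λ x → - x) (fromℕ≡ι (suc n))

  evalℤ≡eval : ∀ f x → evalℤ f x ≡ eval f x
  evalℤ≡eval [] x = ≡.refl
  evalℤ≡eval (a ∷ f) x = ≡.cong₂ (λ a y → a + x * y) (fromℤ≡ι a) (evalℤ≡eval f x)

  eval+ε : ZPoly → Carrier → Dual
  eval+ε f a = Dᵉ.eval f (a +ε)

  eval+ε-proj₁ : ∀ f a → proj₁ (eval+ε f a) ≈ eval f a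
  eval+ε-proj₁ [] a = refl
  eval+ε-proj₁ (b ∷ f) a = +-cong (proj₁ (ι-dual b)) (*-congˡ (eval+ε-proj₁ f a))

  proj₁-^ : ∀ a n → proj₁ ((a +ε) Dᶻ.^ n) ≈ a ^ n
  proj₁-^ a zero = refl
  proj₁-^ a (suc n) = *-congˡ (proj₁-^ a n)

  reduce-monic : ∀ {d f} → Monic d f → ∃ λ (v : Vec Carrier d) →
    (∀ a → eval f a ≈ evalMonic v a) × (∀ a → eval+ε f a D.≈ evalMonic+ε v a)
  reduce-monic (g , ≡.refl , ≡.refl) = Vec.map ι (Vec.fromList g) , go g , goε g
    where
    go : ∀ g a → eval (g ++ + 1 ∷ []) a ≈ evalMonic (Vec.map ι (Vec.fromList g)) a
    go [] a = trans (+-cong ι-1 (zeroʳ a)) (+-identityʳ 1#)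
    go (b ∷ g) a = +-congˡ (*-congˡ (go g a))
    goε : ∀ g a → eval+ε (g ++ + 1 ∷ []) a D.≈ evalMonic+ε (Vec.map ι (Vec.fromList g)) a
    goε [] a = D.trans (D.+-cong Dᶻ.ι-1 (D.zeroʳ (a +ε))) (D.+-identityʳ D.1#)
    goε (b ∷ g) a = D.+-cong (ι-dual b) (D.*-congˡ {a +ε} (goε g a))

  -- Vanishing at points of the field says nothing about ε-components by itself. Enough distinct
  -- roots kill the coefficients, and with them every value at a + ε.
  eval+ε-vanishes : ∀ r as → length r ≤ length as → AllPairs _≉_ as → All (λ a → eval r a ≈ 0#) as →
    ∀ a → eval+ε r a D.≈ D.0#
  eval+ε-vanishes r as len distinct roots = coefficients≈0 r
    (too-many-roots (Vec.map ι (Vec.fromList r)) as len distinct (All.map (trans (sym (eval≈ r _))) roots))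
    where
    eval≈ : ∀ r a → eval r a ≈ evalVec (Vec.map ι (Vec.fromList r)) a
    eval≈ [] a = refl
    eval≈ (b ∷ r) a = +-congˡ (*-congˡ (eval≈ r a))
    coefficients≈0 : ∀ r → VecAll.All (_≈ 0#) (Vec.map ι (Vec.fromList r)) → ∀ a → eval+ε r a D.≈ D.0#
    coefficients≈0 [] _ a = D.refl
    coefficients≈0 (b ∷ r) (b≈0 VecAll.∷ r≈0) a = D.trans
      (D.+-cong (D.trans (ι-dual b) (b≈0 , refl)) (D.trans (D.*-congˡ {a +ε} (coefficients≈0 r r≈0 a)) (D.zeroʳ (a +ε))))
      (D.+-identityˡ D.0#)

  zero-factor : ∀ fs {a} → eval (prodP fs) a ≈ 0# → ¬ ¬ Any (λ f → eval f a ≈ 0#) fs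
  zero-factor [] {a} eq _ = 1≉0 (trans (sym (trans (+-cong ι-1 (zeroʳ a)) (+-identityʳ 1#))) eq)
  zero-factor (f ∷ fs) {a} eq k = no-zero-divisors (trans (sym (eval-mulP f (prodP fs) a)) eq) λ where
    (inj₁ eq₁) → k (here eq₁)
    (inj₂ eq₂) → zero-factor fs eq₂ λ any → k (there any)

  zero-product : ∀ {fs a} → Any (λ f → eval f a ≈ 0#) fs → eval (prodP fs) a ≈ 0#
  zero-product {f ∷ fs} {a} (here eq) = trans (eval-mulP f (prodP fs) a) (trans (*-congʳ eq) (zeroˡ _))
  zero-product {f ∷ fs} {a} (there any) = trans (eval-mulP f (prodP fs) a) (trans (*-congˡ (zero-product any)) (zeroʳ _))

  power-of-one : ∀ {a m} → a ^ m ≈ 1# → ∀ k → a ^ (k ℕ.* m) ≈ 1#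
  power-of-one {a} {m} eq k = trans (^-congʳ a (ℕₚ.*-comm k m))
    (trans (sym (^-assocʳ a m k)) (trans (^-congˡ k eq) (1^n≈1 k)))

  gcd-power : ∀ {a} m n → a ^ m ≈ 1# → a ^ n ≈ 1# → a ^ gcd m n ≈ 1#
  gcd-power {a} m n am an with Bézout.identity (gcd-GCD m n)
  ... | Bézout.+- x y eq = trans (sym (*-identityʳ _)) (trans (*-congˡ (sym (power-of-one an y)))
    (trans (sym (^-homo-* a (gcd m n) (y ℕ.* n))) (trans (^-congʳ a eq) (power-of-one am x))))
  ... | Bézout.-+ x y eq = trans (sym (*-identityʳ _)) (trans (*-congˡ (sym (power-of-one am x)))
    (trans (sym (^-homo-* a (gcd m n) (x ℕ.* m))) (trans (^-congʳ a eq) (power-of-one an y))))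

  -- The identity x^d - 1 = Φ_d ∏ Φ_e, e running over the proper divisors of d, in the form that
  -- root counting uses: for the values at all a + ε, not for integer coefficients.
  record Factorisation (d : ℕ) : Set (c ⊔ ℓ) where
    field
      {degree} : ℕ
      monic : Monic degree (cyclotomic d)
      product : ∀ a → eval+ε (cyclotomic d) a D.* eval+ε (properProduct d) a D.≈ (a +ε) Dᶻ.^ d D.- D.1#

    product₁ : ∀ a → eval (cyclotomic d) a * eval (properProduct d) a ≈ a ^ d - 1#
    product₁ a = trans (*-cong (sym (eval+ε-proj₁ (cyclotomic d) a)) (sym (eval+ε-proj₁ (properProduct d) a)))
      (trans (proj₁ (product a)) (+-congʳ (proj₁-^ a d)))

    root-power : ∀ {a} → eval (cyclotomic d) a ≈ 0# → a ^ d ≈ 1#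
    root-power {a} eq = x-y≈0⇒x≈y (trans (sym (product₁ a)) (trans (*-congʳ eq) (zeroˡ _)))

    power-root : ∀ {a} → 1 ≤ d → a ^ d ≈ 1# → ¬ ¬ ∃ λ e → 1 ≤ e × e ∣ d × eval (cyclotomic e) a ≈ 0#
    power-root {a} 1≤d eq k = no-zero-divisors (trans (product₁ a) (x≈y⇒x-y≈0 eq)) λ where
        (inj₁ root) → k (d , 1≤d , ∣-refl , root)
        (inj₂ root) → zero-factor (map proj₂ (properDivisors d)) root λ any →
          k (find (properDivisors-entries d) (Anyₚ.map⁻ any))
      where
      find : ∀ {L} → All (λ (e , f) → 1 ≤ e × e < d × e ∣ d × f ≡ cyclotomic e) L →
        Any (λ (_ , f) → eval f a ≈ 0#) L → ∃ λ e → 1 ≤ e × e ∣ d × eval (cyclotomic e) a ≈ 0#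
      find ((1≤e , _ , e∣d , ≡.refl) ∷ _) (here root) = _ , 1≤e , e∣d , root
      find (_ ∷ all) (there any) = find all any

  open Factorisation

  -- If a^k = 1, then a^g = 1 for g = gcd(k, d) < d, so a is a root of some Φ_e with e dividing g.
  -- This Φ_e is a factor of `properProduct d`, and a becomes a double root of x^d - 1.
  root-order : ∀ d → ι (+ d) ≉ 0# → (∀ {e} → 1 ≤ e → e ∣ d → Factorisation e) →
    ∀ {a} → eval (cyclotomic d) a ≈ 0# → ∀ {k} → 1 ≤ k → k < d → a ^ k ≉ 1#
  root-order d@(suc n) d≉0 fact {a} root {k} 1≤k k<d eq =
    power-root (fact 1≤g g∣d) 1≤g (gcd-power k d eq (root-power factᵈ root)) λ (e , 1≤e , e∣g , rootᵉ) →
      no-double-root n a d≉0 (eval+ε (cyclotomic d) a) (eval+ε (properProduct d) a) (product factᵈ a)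
        (trans (eval+ε-proj₁ (cyclotomic d) a) root)
        (trans (eval+ε-proj₁ (properProduct d) a) (zero-product (Any.map (λ { ≡.refl → rootᵉ })
          (∈-map⁺ proj₂ (properDivisors-complete 1≤e (ℕₚ.≤-<-trans (∣⇒≤ {{ℕ.>-nonZero 1≤g}} e∣g) g<d) (∣-trans e∣g g∣d))))))
    where
    g = gcd k d
    g∣d : g ∣ d
    g∣d = gcd[m,n]∣n k d
    g∣k : g ∣ k
    g∣k = gcd[m,n]∣m k d
    g≤k : g ≤ k
    g≤k = ∣⇒≤ {{ℕ.>-nonZero 1≤k}} g∣k
    g<d : g < d
    g<d = ℕₚ.≤-<-trans g≤k k<d
    1≤g : 1 ≤ g
    1≤g = ℕₚ.n≢0⇒n>0 λ g≡0 → ℕₚ.<-irrefl (≡.sym (0∣⇒≡0 (subst (_∣ k) g≡0 g∣k))) 1≤k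
    factᵈ = fact (s≤s z≤n) ∣-refl

  -- The remainder of the division defining Φ_d vanishes at deg (properProduct d) distinct points:
  -- the roots of the Φ_e with e a proper divisor of d, which have exact orders e.
  factorisation-step : ∀ d → 1 ≤ d → (∀ {e} → e ∣ d → ι (+ e) ≉ 0#) →
    (∀ {e} → 1 ≤ e → e < d → e ∣ d → Factorisation e) → Factorisation d
  factorisation-step d@(suc n) 1≤d ≉0 fact = record { monic = Monic-divMonic mA mB k≤d ; product = product′ }
    where
    Entry : ℕ × ZPoly → Set
    Entry (e , f) = 1 ≤ e × e < d × e ∣ d × f ≡ cyclotomic e

    factors : ∀ {e} → 1 ≤ e → e < d → e ∣ d → ∀ {h} → 1 ≤ h → h ∣ e → Factorisation h
    factors 1≤e e<d e∣d 1≤h h∣e = fact 1≤h (ℕₚ.≤-<-trans (∣⇒≤ {{ℕ.>-nonZero 1≤e}} h∣e) e<d) (∣-trans h∣e e∣d)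

    roots-of : ∀ {e} → 1 ≤ e → (fe : Factorisation e) → ι (+ e) ≉ 0# → DistinctRoots (eval (cyclotomic e)) (degree fe)
    roots-of {e@(suc m)} _ fe e≉0 =
      let v , v≈ , v≈ε = reduce-monic (monic fe)
          as , len , distinct , roots = divisor-of-xn-1-splits closed m e≉0 v (eval+ε (properProduct e))
            (λ x → D.trans (D.*-congʳ {eval+ε (properProduct e) x} (D.sym (v≈ε x))) (product fe x))
      in as , len , distinct , All.map (λ {a} → trans (v≈ a)) roots

    collect : ∀ {L} → All Entry L → AllPairs (λ x y → proj₁ x < proj₁ y) L →
      ∃ λ k → Monic k (prodP (map proj₂ L)) × ∃ λ as → length as ≡ k × AllPairs _≉_ as ×
        All (λ a → Any (λ (_ , f) → eval f a ≈ 0#) L) as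
    collect [] [] = 0 , Monic-1 , [] , ≡.refl , [] , []
    collect {(e , _) ∷ L} ((1≤e , e<d , e∣d , ≡.refl) ∷ entries) (e< ∷ sorted) =
      let fe = fact 1≤e e<d e∣d
          as , len , distinct , roots = roots-of 1≤e fe (≉0 e∣d)
          k , mL , bs , lenᵇ , distinctᵇ , rootsᵇ = collect entries sorted
      in _ , Monic-mulP (monic fe) mL , as ++ bs ,
         ≡.trans (Listₚ.length-++ as) (≡.cong₂ ℕ._+_ len lenᵇ) ,
         AllPairsₚ.++⁺ distinct distinctᵇ (All.map (λ root → All.map (λ any a≈b →
           clash entries e< (trans (^-congˡ e (sym a≈b)) (root-power fe root)) any) rootsᵇ) roots) ,
         Allₚ.++⁺ (All.map here roots) (All.map there rootsᵇ)
      where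
      -- Roots of the later Φ_e′ have exact order e′ > e, so none of them satisfies b^e = 1.
      clash : ∀ {L} → All Entry L → All (λ y → e < proj₁ y) L → ∀ {b} → b ^ e ≈ 1# →
        ¬ Any (λ (_ , f) → eval f b ≈ 0#) L
      clash ((1≤e′ , e′<d , e′∣d , ≡.refl) ∷ _) (e<e′ ∷ _) eq (here root) =
        root-order _ (≉0 e′∣d) (factors 1≤e′ e′<d e′∣d) root 1≤e e<e′ eq
      clash (_ ∷ all) (_ ∷ all<) eq (there any) = clash all all< eq any

    collected = collect (properDivisors-entries d) (properDivisors-sorted d)
    k = proj₁ collected
    mA = Monic-xn-1 n
    mB = proj₁ (proj₂ collected)
    as = proj₁ (proj₂ (proj₂ collected))
    len = proj₁ (proj₂ (proj₂ (proj₂ collected)))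
    distinct = proj₁ (proj₂ (proj₂ (proj₂ (proj₂ collected))))
    roots = proj₂ (proj₂ (proj₂ (proj₂ (proj₂ collected))))

    rootsB : All (λ a → eval (properProduct d) a ≈ 0#) as
    rootsB = All.map (λ any → zero-product (Anyₚ.map⁺ any)) roots

    rootsA : All (λ a → eval (xn-1 d) a ≈ 0#) as
    rootsA = All.map (λ {a} any → trans (eval-xn-1 n a) (x≈y⇒x-y≈0 (root-of-unity (properDivisors-entries d) any))) roots
      where
      root-of-unity : ∀ {L a} → All Entry L → Any (λ (_ , f) → eval f a ≈ 0#) L → a ^ d ≈ 1#
      root-of-unity {a = a} ((1≤e , e<d , e∣d@(divides q eq) , ≡.refl) ∷ _) (here root) =
        trans (^-congʳ a eq) (power-of-one (root-power (fact 1≤e e<d e∣d) root) q)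
      root-of-unity (_ ∷ all) (there any) = root-of-unity all any

    -- The degree of the product is bounded through its roots instead of a totient sum: `as`
    -- consists of k distinct roots of x^d - 1.
    k≤d : k ≤ d
    k≤d = ℕₚ.≮⇒≥ λ d<k →
      let v , v≈ , _ = reduce-monic mA
      in too-many-roots-monic v as (subst (d <_) (≡.sym len) d<k) distinct
           (All.map (λ {a} → trans (sym (v≈ a))) rootsA)

    R = divMonic-remainder mA mB k≤d

    rootsR : All (λ a → eval R a ≈ 0#) as
    rootsR = All.zipWith (λ {a} (rootA , rootB) → begin
      eval R a                                                       ≈⟨ +-identityˡ _ ⟨
      0# + eval R a                                                  ≈⟨ +-congʳ (trans (*-congˡ rootB) (zeroʳ _)) ⟨
      eval (cyclotomic d) a * eval (properProduct d) a + eval R a    ≈⟨ eval-divMonic mA mB k≤d commutativeRing a ⟨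
      eval (xn-1 d) a                                                ≈⟨ rootA ⟩
      0#                                                             ∎) (rootsA , rootsB)
      where open Relation.Binary.Reasoning.Setoid setoid

    product′ : ∀ a → eval+ε (cyclotomic d) a D.* eval+ε (properProduct d) a D.≈ (a +ε) Dᶻ.^ d D.- D.1#
    product′ a = begin
      QB                         ≈⟨ D.+-identityʳ QB ⟨
      QB D.+ D.0#                ≈⟨ D.+-congˡ {QB} (eval+ε-vanishes R as (ℕₚ.≤-reflexive
                                      (≡.trans (length-divMonic-remainder mA mB k≤d) (≡.sym len))) distinct rootsR a) ⟨
      QB D.+ eval+ε R a          ≈⟨ eval-divMonic mA mB k≤d dualRing (a +ε) ⟨
      eval+ε (xn-1 d) a          ≈⟨ Dᵉ.eval-xn-1 n (a +ε) ⟩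
      (a +ε) Dᶻ.^ d D.- D.1#     ∎
      where
      open Relation.Binary.Reasoning.Setoid D.setoid
      QB = eval+ε (cyclotomic d) a D.* eval+ε (properProduct d) a

  module _ {N} (1≤N : 1 ≤ N) (N≉0 : ι (+ N) ≉ 0#) where

    divisor≉0 : ∀ {d} → d ∣ N → ι (+ d) ≉ 0#
    divisor≉0 {d} (divides q eq) d≈0 = N≉0 (trans (reflexive (cong (λ k → ι (+ k)) eq))
      (trans (reflexive (cong ι (ℤₚ.pos-* q d))) (trans (ι-* (+ q) (+ d)) (trans (*-congˡ d≈0) (zeroʳ _)))))

    factorisation : ∀ d → 1 ≤ d → d ∣ N → Factorisation d
    factorisation = <-rec (λ d → 1 ≤ d → d ∣ N → Factorisation d) λ d rec 1≤d d∣N → factorisation-step d 1≤d (λ e∣d → divisor≉0 (∣-trans e∣d d∣N))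
      λ 1≤e e<d e∣d → rec e<d 1≤e (∣-trans e∣d d∣N)

    cyclotomic-root-power : ∀ {ζ} → evalℤ (cyclotomic N) ζ ≈ 0# → ζ ^ N ≈ 1#
    cyclotomic-root-power {ζ} root =
      root-power (factorisation N 1≤N ∣-refl) (trans (reflexive (≡.sym (evalℤ≡eval (cyclotomic N) ζ))) root)

    cyclotomic-root-order : ∀ {ζ} → evalℤ (cyclotomic N) ζ ≈ 0# → ∀ k → ζ ^ k ≈ 1# → N ∣ k
    cyclotomic-root-order {ζ} root k eq = m%n≡0⇒n∣m k N (≡0 (k % N) (m%n<n k N) ζ^r≈1)
      where
      instance _ = ℕ.>-nonZero 1≤N
      ζ^r≈1 : ζ ^ (k % N) ≈ 1#
      ζ^r≈1 = begin
        ζ ^ (k % N)                            ≈⟨ *-identityʳ _ ⟨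
        ζ ^ (k % N) * 1#                       ≈⟨ *-congˡ (power-of-one (cyclotomic-root-power root) (k / N)) ⟨
        ζ ^ (k % N) * ζ ^ (k / N ℕ.* N)        ≈⟨ ^-homo-* ζ (k % N) _ ⟨
        ζ ^ (k % N ℕ.+ k / N ℕ.* N)            ≡⟨ cong (ζ ^_) (m≡m%n+[m/n]*n k N) ⟨
        ζ ^ k                                  ≈⟨ eq ⟩
        1#                                     ∎
        where open Relation.Binary.Reasoning.Setoid setoid
      ≡0 : ∀ r → r < N → ζ ^ r ≈ 1# → r ≡ 0
      ≡0 zero _ _ = ≡.refl
      ≡0 (suc r) r<N eq = ⊥-elim (root-order N N≉0 (λ 1≤e e∣N → factorisation _ 1≤e e∣N)
        (trans (reflexive (≡.sym (evalℤ≡eval (cyclotomic N) ζ))) root) (s≤s z≤n) r<N eq)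

-- Frobenius conjugates and minimal polynomials

prime∤! : ∀ {p} → Prime p → ∀ k → k < p → ¬ p ∣ k !
prime∤! {p} pp zero _ p∣1 = ℕₚ.<⇒≢ (ℕ.nonTrivial⇒n>1 p {{prime⇒nonTrivial pp}}) (≡.sym (∣1⇒≡1 p∣1))
prime∤! pp (suc k) k<p p∣ with euclidsLemma (suc k) (k !) pp p∣
... | inj₁ p∣k = ℕₚ.<⇒≱ k<p (∣⇒≤ p∣k)
... | inj₂ p∣k! = prime∤! pp k (ℕₚ.<-trans (ℕₚ.n<1+n k) k<p) p∣k!

prime∣C : ∀ {p} → Prime p → ∀ {k} → 0 < k → k < p → p ∣ (p C k)
prime∣C {zero} _ _ ()
prime∣C {p@(suc n)} pp {k} 0<k k<p with euclidsLemma (p C k) (k ! ℕ.* (p ∸ k) !) pp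
  (subst (p ∣_) (≡.sym C*) (m∣m*n (n !)))
  where
  C* : (p C k) ℕ.* (k ! ℕ.* (p ∸ k) !) ≡ p !
  C* = ≡.trans (cong (ℕ._* (k ! ℕ.* (p ∸ k) !)) (nCk≡n!/k![n-k]! (ℕₚ.<⇒≤ k<p)))
    (m/n*n≡m {{k ℕₚ.!* (p ∸ k) !≢0}} (k![n∸k]!∣n! (ℕₚ.<⇒≤ k<p)))
... | inj₁ p∣C = p∣C
... | inj₂ p∣ with euclidsLemma (k !) ((p ∸ k) !) pp p∣
...   | inj₁ p∣k! = ⊥-elim (prime∤! pp k k<p p∣k!)
...   | inj₂ p∣! = ⊥-elim (prime∤! pp (p ∸ k) (ℕₚ.∸-monoʳ-< 0<k (ℕₚ.<⇒≤ k<p)) p∣!)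

module Frobenius {c ℓ} (F : Field c ℓ) {p : ℕ} (pp : Prime p)
  (char : Field._≈_ F (FieldTheory.ι F (+ p)) (Field.0# F)) where
  open Field F hiding (zero)
  open FieldOps F using (evalMonic; embed; evalMonicℤp; RootOfMonicDeg; MinPolyDegree)
  open FieldTheory F
  open Mult semiring using () renaming (_×_ to _·_; ×-assoc-* to ·-assoc-*; ×-congʳ to ·-congʳ)
  open Sum semiring using (sum; sum-cong-≋; sum-replicate-zero; sum-init-last)
  open CommutativeExp commutativeSemiring using (^-distrib-*)
  open Relation.Binary.Reasoning.Setoid setoid

  0<p : 0 < p
  0<p = ℕₚ.<-trans (s≤s z≤n) (ℕ.nonTrivial⇒n>1 p {{prime⇒nonTrivial pp}})

  multiple≈0 : ∀ {n} → p ∣ n → ι (+ n) ≈ 0#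
  multiple≈0 {n} (divides q eq) = begin
    ι (+ n)             ≡⟨ cong ι (≡.trans (cong +_ eq) (ℤₚ.pos-* q p)) ⟩
    ι (+ q ℤ.* + p)     ≈⟨ ι-* (+ q) (+ p) ⟩
    ι (+ q) * ι (+ p)   ≈⟨ *-congˡ char ⟩
    ι (+ q) * 0#        ≈⟨ zeroʳ _ ⟩
    0#                  ∎

  coprime≉0 : ∀ {n} → Coprime n p → ι (+ n) ≉ 0#
  coprime≉0 {n} cop n≈0 with coprime-Bézout cop
  ... | Bézout.+- x y eq = 1≉0 (begin
    1#                                ≈⟨ ι-1 ⟨
    ι (+ 1)                           ≈⟨ +-identityʳ _ ⟨
    ι (+ 1) + 0#                      ≈⟨ +-congˡ (multiple≈0 (divides y ≡.refl)) ⟨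
    ι (+ 1) + ι (+ (y ℕ.* p))         ≈⟨ ι-+ (+ 1) (+ (y ℕ.* p)) ⟨
    ι (+ (1 ℕ.+ y ℕ.* p))             ≡⟨ cong ι (≡.trans (cong +_ eq) (ℤₚ.pos-* x n)) ⟩
    ι (+ x ℤ.* + n)                   ≈⟨ ι-* (+ x) (+ n) ⟩
    ι (+ x) * ι (+ n)                 ≈⟨ *-congˡ n≈0 ⟩
    ι (+ x) * 0#                      ≈⟨ zeroʳ _ ⟩
    0#                                ∎)
  ... | Bézout.-+ x y eq = 1≉0 (begin
    1#                                ≈⟨ ι-1 ⟨
    ι (+ 1)                           ≈⟨ +-identityʳ _ ⟨
    ι (+ 1) + 0#                      ≈⟨ +-congˡ (trans (trans (reflexive (cong ι (ℤₚ.pos-* x n))) (ι-* (+ x) (+ n)))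
                                           (trans (*-congˡ n≈0) (zeroʳ _))) ⟨
    ι (+ 1) + ι (+ (x ℕ.* n))         ≈⟨ ι-+ (+ 1) (+ (x ℕ.* n)) ⟨
    ι (+ (1 ℕ.+ x ℕ.* n))             ≈⟨ multiple≈0 (divides y eq) ⟩
    0#                                ∎)

  frobenius-+ : ∀ x y → (x + y) ^ p ≈ x ^ p + y ^ p
  frobenius-+ x y = go p ≡.refl
    where
    open Binomial commutativeSemiring using (binomialTerm) renaming (theorem to binomial-theorem)
    middle : ∀ {k} → 0 < k → k < p → ∀ z → (p C k) · z ≈ 0#
    middle {k} 0<k k<p z = trans (·-congʳ (p C k) (sym (*-identityˡ z))) (trans (sym (·-assoc-* (p C k) 1# z))
      (trans (*-congʳ (multiple≈0 (prime∣C pp 0<k k<p))) (zeroˡ z)))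
    go : ∀ n → n ≡ p → (x + y) ^ n ≈ x ^ n + y ^ n
    go zero ≡.refl = ⊥-elim (ℕₚ.<-irrefl ≡.refl 0<p)
    go n@(suc m) ≡.refl = begin
      (x + y) ^ n                             ≈⟨ binomial-theorem n x y ⟩
      term Fin.zero + sum (term ∘ Fin.suc)    ≈⟨ +-cong first (trans (sum-init-last (term ∘ Fin.suc)) (+-cong inner last)) ⟩
      y ^ n + (0# + x ^ n)                    ≈⟨ trans (+-congˡ (+-identityˡ _)) (+-comm _ _) ⟩
      x ^ n + y ^ n                           ∎
      where
      term = binomialTerm x y n
      first : term Fin.zero ≈ y ^ n
      first = trans (+-identityʳ _) (*-identityˡ _)
      inner : sum (λ i → term (Fin.suc (Fin.inject₁ i))) ≈ 0#
      inner = trans (sum-cong-≋ λ i → middle (s≤s z≤n)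
        (s≤s (subst (_< m) (≡.sym (Finₚ.toℕ-inject₁ i)) (Finₚ.toℕ<n i))) _) (sum-replicate-zero m)
      last : term (Fin.suc (Fin.fromℕ m)) ≈ x ^ n
      last rewrite Finₚ.toℕ-fromℕ m | nCn≡1 n | ℕₚ.n∸n≡0 m = trans (+-identityʳ _) (*-identityʳ _)

  frobenius-0 : 0# ^ p ≈ 0#
  frobenius-0 = go 0<p
    where
    go : ∀ {n} → 0 < n → 0# ^ n ≈ 0#
    go {suc n} _ = zeroˡ _

  -- Additivity applied to -x + x gives the sign without a case distinction on the parity of p.
  frobenius-neg : ∀ x → (- x) ^ p ≈ - (x ^ p)
  frobenius-neg x = x-y≈0⇒x≈y (begin
    (- x) ^ p - - (x ^ p)   ≈⟨ solve 2 (λ u v → u :- (:- v) := u :+ v) refl _ _ ⟩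
    (- x) ^ p + x ^ p       ≈⟨ frobenius-+ (- x) x ⟨
    (- x + x) ^ p           ≈⟨ ^-congˡ p (-‿inverseˡ x) ⟩
    0# ^ p                  ≈⟨ frobenius-0 ⟩
    0#                      ∎)

  -- By additivity (x - y)^p = x^p - y^p = 0, whereas powers of nonzero elements are nonzero.
  frobenius-injective : ∀ {x y} → x ^ p ≈ y ^ p → ¬ x ≉ y
  frobenius-injective {x} {y} eq x≉y = ^-≉0 p (x≉y ∘ x-y≈0⇒x≈y)
    (trans (frobenius-+ x (- y)) (trans (+-congˡ (frobenius-neg y)) (x≈y⇒x-y≈0 eq)))

  ^-p^suc : ∀ x k → x ^ (p ℕ.^ suc k) ≈ (x ^ p) ^ (p ℕ.^ k)
  ^-p^suc x k = sym (^-assocʳ x p (p ℕ.^ k))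

  ^-p^+ : ∀ x i j → x ^ (p ℕ.^ (i ℕ.+ j)) ≈ (x ^ (p ℕ.^ i)) ^ (p ℕ.^ j)
  ^-p^+ x i j = trans (^-congʳ x (ℕₚ.^-distribˡ-+-* p i j)) (sym (^-assocʳ x (p ℕ.^ i) (p ℕ.^ j)))

  frobeniusᵏ-+ : ∀ k x y → (x + y) ^ (p ℕ.^ k) ≈ x ^ (p ℕ.^ k) + y ^ (p ℕ.^ k)
  frobeniusᵏ-+ zero x y = trans (*-identityʳ _) (sym (+-cong (*-identityʳ x) (*-identityʳ y)))
  frobeniusᵏ-+ (suc k) x y = begin
    (x + y) ^ (p ℕ.^ suc k)                          ≈⟨ ^-p^suc (x + y) k ⟩
    ((x + y) ^ p) ^ (p ℕ.^ k)                        ≈⟨ ^-congˡ (p ℕ.^ k) (frobenius-+ x y) ⟩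
    (x ^ p + y ^ p) ^ (p ℕ.^ k)                      ≈⟨ frobeniusᵏ-+ k (x ^ p) (y ^ p) ⟩
    (x ^ p) ^ (p ℕ.^ k) + (y ^ p) ^ (p ℕ.^ k)        ≈⟨ +-cong (^-p^suc x k) (^-p^suc y k) ⟨
    x ^ (p ℕ.^ suc k) + y ^ (p ℕ.^ suc k)            ∎

  frobeniusᵏ-injective : ∀ k {x y} → x ^ (p ℕ.^ k) ≈ y ^ (p ℕ.^ k) → ¬ x ≉ y
  frobeniusᵏ-injective zero eq x≉y = x≉y (trans (sym (*-identityʳ _)) (trans eq (*-identityʳ _)))
  frobeniusᵏ-injective (suc k) {x} {y} eq x≉y =
    frobeniusᵏ-injective k (trans (sym (^-p^suc x k)) (trans eq (^-p^suc y k))) λ eq′ →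
      frobenius-injective eq′ x≉y

  frobenius-ι : ∀ n → ι (+ n) ^ p ≈ ι (+ n)
  frobenius-ι zero = frobenius-0
  frobenius-ι (suc n) = trans (frobenius-+ 1# (ι (+ n))) (+-cong (1^n≈1 p) (frobenius-ι n))

  frobenius-embed : ∀ (i : Fin p) → embed i ^ p ≈ embed i
  frobenius-embed i rewrite fromℕ≡ι (toℕ i) = frobenius-ι (toℕ i)

  evalMonicℤp-frobenius : ∀ {d} (cs : Vec (Fin p) d) x → evalMonicℤp cs (x ^ p) ≈ evalMonicℤp cs x ^ p
  evalMonicℤp-frobenius [] x = sym (1^n≈1 p)
  evalMonicℤp-frobenius (i ∷ cs) x = begin
    embed i + x ^ p * evalMonicℤp cs (x ^ p)      ≈⟨ +-cong (frobenius-embed i) (*-congˡ (sym (evalMonicℤp-frobenius cs x))) ⟨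
    embed i ^ p + x ^ p * evalMonicℤp cs x ^ p    ≈⟨ +-congˡ (^-distrib-* x _ p) ⟨
    embed i ^ p + (x * evalMonicℤp cs x) ^ p      ≈⟨ frobenius-+ _ _ ⟨
    (embed i + x * evalMonicℤp cs x) ^ p          ∎

  evalMonicℤp≡ : ∀ {d} (cs : Vec (Fin p) d) x → evalMonicℤp cs x ≡ evalMonic (Vec.map embed cs) x
  evalMonicℤp≡ [] x = ≡.refl
  evalMonicℤp≡ (i ∷ cs) x = cong (λ y → embed i + x * y) (evalMonicℤp≡ cs x)

  evalMonicℤp-cong : ∀ {d} (cs : Vec (Fin p) d) {x y} → x ≈ y → evalMonicℤp cs x ≈ evalMonicℤp cs y
  evalMonicℤp-cong [] _ = refl
  evalMonicℤp-cong (i ∷ cs) x≈y = +-congˡ (*-cong x≈y (evalMonicℤp-cong cs x≈y))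

  root-conjugate : ∀ {d} (cs : Vec (Fin p) d) {x} → evalMonicℤp cs x ≈ 0# → ∀ k → evalMonicℤp cs (x ^ (p ℕ.^ k)) ≈ 0#
  root-conjugate cs eq zero = trans (evalMonicℤp-cong cs (*-identityʳ _)) eq
  root-conjugate cs {x} eq (suc k) = trans (evalMonicℤp-cong cs (^-p^suc x k))
    (root-conjugate cs (trans (evalMonicℤp-frobenius cs x) (trans (^-congˡ p eq) frobenius-0)) k)

  -- The d + 1 conjugates α^(p^i) with i ≤ d cannot all be distinct. If those at i < j agree,
  -- injectivity of x ↦ x^(p^i) gives the period j - i ≤ d.
  root⇒periodic : ∀ {α d} → RootOfMonicDeg p α d → ¬ ¬ ∃ λ k → 1 ≤ k × k ≤ d × α ^ (p ℕ.^ k) ≈ α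
  root⇒periodic {α} {d} (cs , root) none = too-many-roots-monic (Vec.map embed cs) conjugates
    (ℕₚ.≤-reflexive (≡.sym (Listₚ.length-applyUpTo conjugate (suc d))))
    (AllPairsₚ.applyUpTo⁺₁ conjugate (suc d) distinct)
    (Allₚ.applyUpTo⁺₂ conjugate (suc d) λ i →
      trans (reflexive (≡.sym (evalMonicℤp≡ cs (conjugate i)))) (root-conjugate cs root i))
    where
    conjugate : ℕ → Carrier
    conjugate i = α ^ (p ℕ.^ i)
    conjugates = applyUpTo conjugate (suc d)
    distinct : ∀ {i j} → i < j → j < suc d → conjugate i ≉ conjugate j
    distinct {i} {j} i<j (s≤s j≤d) eq = frobeniusᵏ-injective i
      (trans (sym (trans (^-congʳ α (cong (p ℕ.^_) (≡.sym (ℕₚ.m∸n+n≡m (ℕₚ.<⇒≤ i<j))))) (^-p^+ α (j ∸ i) i))) (sym eq))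
      λ eq′ → none (j ∸ i , ℕₚ.m<n⇒0<n∸m i<j , ℕₚ.≤-trans (ℕₚ.m∸n≤m j i) j≤d , eq′)

  -- The images of 0, ..., p - 1 are p distinct roots of y^p - y; a fixed `x` outside them would be
  -- one root too many.
  fixed⇒prime-field : ∀ {x} → x ^ p ≈ x → ¬ ¬ ∃ λ (i : Fin p) → embed i ≈ x
  fixed⇒prime-field {x} fixed none = go p ≡.refl
    where
    element : ℕ → Carrier
    element i = ι (+ i)
    distinct : ∀ {i j} → i < j → j < p → element i ≉ element j
    distinct {i} {j} i<j j<p eq = coprime≉0 (Coprimality.sym (prime⇒coprime pp
        {{ℕ.>-nonZero (ℕₚ.m<n⇒0<n∸m i<j)}} (ℕₚ.≤-<-trans (ℕₚ.m∸n≤m j i) j<p))) (begin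
      ι (+ (j ∸ i))                    ≈⟨ solve 2 (λ a b → b := (a :+ b) :- a) refl (ι (+ i)) _ ⟩
      (ι (+ i) + ι (+ (j ∸ i))) - ι (+ i)   ≈⟨ +-congʳ (ι-+ (+ i) (+ (j ∸ i))) ⟨
      ι (+ (i ℕ.+ (j ∸ i))) - ι (+ i)  ≡⟨ cong (λ k → ι (+ k) - ι (+ i)) (ℕₚ.m+[n∸m]≡n (ℕₚ.<⇒≤ i<j)) ⟩
      ι (+ j) - ι (+ i)                ≈⟨ x≈y⇒x-y≈0 (sym eq) ⟩
      0#                               ∎)
    go : ∀ n → n ≡ p → ⊥
    go zero ≡.refl = ℕₚ.<-irrefl ≡.refl 0<p
    go (suc zero) ≡.refl = ℕₚ.<-irrefl ≡.refl (ℕ.nonTrivial⇒n>1 p {{prime⇒nonTrivial pp}})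
    go n@(suc (suc m)) ≡.refl = too-many-roots-monic xᵖ-x (x ∷ applyUpTo element p)
      (ℕₚ.≤-reflexive (cong suc (≡.sym (Listₚ.length-applyUpTo element p))))
      (Allₚ.applyUpTo⁺₁ element p (λ {i} i<p eq → none (fromℕ< i<p ,
         trans (reflexive (≡.trans (fromℕ≡ι (toℕ (fromℕ< i<p))) (cong element (Finₚ.toℕ-fromℕ< i<p)))) (sym eq)))
        ∷ AllPairsₚ.applyUpTo⁺₁ element p distinct)
      (root fixed ∷ Allₚ.applyUpTo⁺₂ element p (λ i → root (frobenius-ι i)))
      where
      -- The coefficients of y^p - y below the leading one. The entries 0 and -1 take up two places,
      -- which is why p is split as m + 2.
      xᵖ-x : Vec Carrier n
      xᵖ-x = 0# ∷ - 1# ∷ Vec.replicate m 0#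
      power : ∀ m y → evalMonic (Vec.replicate m 0#) y ≈ y ^ m
      power zero y = refl
      power (suc m) y = trans (+-identityˡ _) (*-congˡ (power m y))
      root : ∀ {y} → y ^ n ≈ y → evalMonic xᵖ-x y ≈ 0#
      root {y} eq = begin
        0# + y * (- 1# + y * evalMonic (Vec.replicate m 0#) y)  ≈⟨ +-congˡ (*-congˡ (+-congˡ (*-congˡ (power m y)))) ⟩
        0# + y * (- 1# + y * y ^ m)     ≈⟨ solve 3 (λ o y e → con (+ 0) :+ y :* ((:- o) :+ y :* e) := y :* (y :* e) :- y :* o) refl 1# y _ ⟩
        y ^ n - y * 1#                  ≈⟨ x≈y⇒x-y≈0 (trans eq (sym (*-identityʳ y))) ⟩
        0#                              ∎

  -- Polynomials as coefficient sequences; timesLinear a multiplies by x − a.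
  timesLinear : Carrier → (ℕ → Carrier) → ℕ → Carrier
  timesLinear a f zero = - (a * f 0)
  timesLinear a f (suc n) = f n - a * f (suc n)

  timesLinear-cong : ∀ {a b f g} → a ≈ b → (∀ n → f n ≈ g n) → ∀ n → timesLinear a f n ≈ timesLinear b g n
  timesLinear-cong a≈b eq zero = -‿cong (*-cong a≈b (eq 0))
  timesLinear-cong a≈b eq (suc n) = +-cong (eq n) (-‿cong (*-cong a≈b (eq (suc n))))

  timesLinear-comm : ∀ a b f n → timesLinear a (timesLinear b f) n ≈ timesLinear b (timesLinear a f) n
  timesLinear-comm a b f zero = solve 3 (λ a b f → :- (a :* (:- (b :* f))) := :- (b :* (:- (a :* f)))) refl a b (f 0)
  timesLinear-comm a b f (suc zero) = solve 4 (λ a b f g → (:- (b :* f)) :- a :* (f :- b :* g)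
    := (:- (a :* f)) :- b :* (f :- a :* g)) refl a b (f 0) (f 1)
  timesLinear-comm a b f (suc (suc n)) = solve 5 (λ a b f g h → (f :- b :* g) :- a :* (g :- b :* h)
    := (f :- a :* g) :- b :* (g :- a :* h)) refl a b (f n) (f (suc n)) (f (suc (suc n)))

  timesLinear-frobenius : ∀ a f n → timesLinear a f n ^ p ≈ timesLinear (a ^ p) (λ i → f i ^ p) n
  timesLinear-frobenius a f zero = trans (frobenius-neg _) (-‿cong (^-distrib-* a (f 0) p))
  timesLinear-frobenius a f (suc n) = trans (frobenius-+ _ _)
    (+-congˡ (trans (frobenius-neg _) (-‿cong (^-distrib-* a (f (suc n)) p))))

  -- The coefficients of ∏_{i<k} (x − a^(pⁱ)).
  conjugateProduct : ℕ → Carrier → ℕ → Carrier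
  conjugateProduct zero a zero = 1#
  conjugateProduct zero a (suc _) = 0#
  conjugateProduct (suc k) a = timesLinear a (conjugateProduct k (a ^ p))

  -- Commuting the linear factors lets the last conjugate be split off instead of the first.
  -- Frobenius shifts the conjugates by one place, so when the last one returns to `a` the product
  -- is unchanged.
  conjugateProduct-snoc : ∀ k a n →
    conjugateProduct (suc k) a n ≈ timesLinear (a ^ (p ℕ.^ k)) (conjugateProduct k a) n
  conjugateProduct-snoc zero a zero = -‿cong (*-congʳ (sym (*-identityʳ a)))
  conjugateProduct-snoc zero a (suc n) = +-cong (constant n) (-‿cong (*-congʳ (sym (*-identityʳ a))))
    where
    constant : ∀ n → conjugateProduct zero (a ^ p) n ≈ conjugateProduct zero a n
    constant zero = refl
    constant (suc n) = refl
  conjugateProduct-snoc (suc k) a n =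
    trans (timesLinear-cong refl (conjugateProduct-snoc k (a ^ p)) n)
    (trans (timesLinear-comm a _ (conjugateProduct k (a ^ p)) n)
    (timesLinear-cong (sym (^-p^suc a k)) (λ _ → refl) n))

  conjugateProduct-frobenius : ∀ k a n → conjugateProduct k a n ^ p ≈ conjugateProduct k (a ^ p) n
  conjugateProduct-frobenius zero a zero = 1^n≈1 p
  conjugateProduct-frobenius zero a (suc n) = frobenius-0
  conjugateProduct-frobenius (suc k) a n = trans (timesLinear-frobenius a (conjugateProduct k (a ^ p)) n)
    (timesLinear-cong refl (conjugateProduct-frobenius k (a ^ p)) n)

  conjugateProduct-fixed : ∀ {k a} → a ^ (p ℕ.^ suc k) ≈ a → ∀ n → conjugateProduct (suc k) a n ^ p ≈ conjugateProduct (suc k) a n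
  conjugateProduct-fixed {k} {a} eq n = trans (conjugateProduct-frobenius (suc k) a n)
    (trans (conjugateProduct-snoc k (a ^ p) n)
    (timesLinear-cong (trans (sym (^-p^suc a k)) eq) (λ _ → refl) n))

  conjugateProduct-degree : ∀ k a {n} → k < n → conjugateProduct k a n ≈ 0#
  conjugateProduct-degree zero a {suc n} _ = refl
  conjugateProduct-degree (suc k) a {suc n} (s≤s k<n) = trans
    (+-cong (conjugateProduct-degree k (a ^ p) k<n)
      (-‿cong (trans (*-congˡ (conjugateProduct-degree k (a ^ p) (ℕₚ.m<n⇒m<1+n k<n))) (zeroʳ a))))
    (-‿inverseʳ 0#)

  conjugateProduct-monic : ∀ k a → conjugateProduct k a k ≈ 1#
  conjugateProduct-monic zero a = refl
  conjugateProduct-monic (suc k) a = trans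
    (+-cong (conjugateProduct-monic k (a ^ p)) (trans
      (-‿cong (trans (*-congˡ (conjugateProduct-degree k (a ^ p) (ℕₚ.n<1+n k))) (zeroʳ a)))
      (solve 0 (:- con (+ 0) := con (+ 0)) refl)))
    (+-identityʳ 1#)

  partialSum : ℕ → (ℕ → Carrier) → Carrier → Carrier
  partialSum zero f x = 0#
  partialSum (suc n) f x = partialSum n f x + f n * x ^ n

  partialSum-cons : ∀ n f x → partialSum (suc n) f x ≈ f 0 + x * partialSum n (f ∘ suc) x
  partialSum-cons zero f x = trans (+-identityˡ _) (trans (*-identityʳ _) (sym (trans (+-congˡ (zeroʳ x)) (+-identityʳ _))))
  partialSum-cons (suc n) f x = trans (+-congʳ (partialSum-cons n f x))
    (solve 5 (λ f₀ x s fₙ e → (f₀ :+ x :* s) :+ fₙ :* (x :* e) := f₀ :+ x :* (s :+ fₙ :* e)) refl (f 0) x _ (f (suc n)) (x ^ n))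

  -- The correction comes from truncation: the coefficient of x^n in the product contains -a f(n),
  -- but f(n) does not occur in `partialSum n f`.
  partialSum-timesLinear : ∀ n a f x →
    partialSum (suc n) (timesLinear a f) x ≈ (x - a) * partialSum n f x - a * f n * x ^ n
  partialSum-timesLinear zero a f x =
    solve 4 (λ a f x o → con (+ 0) :+ (:- (a :* f)) :* o := (x :- a) :* con (+ 0) :- a :* f :* o) refl a (f 0) x 1#
  partialSum-timesLinear (suc n) a f x = trans (+-congʳ (partialSum-timesLinear n a f x))
    (solve 6 (λ a f g x s e → ((x :- a) :* s :- a :* f :* e) :+ (f :- a :* g) :* (x :* e)
      := (x :- a) :* (s :+ f :* e) :- a :* g :* (x :* e)) refl a (f n) (f (suc n)) x _ (x ^ n))

  conjugateProduct-root : ∀ k a → partialSum (suc (suc k)) (conjugateProduct (suc k) a) a ≈ 0#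
  conjugateProduct-root k a = begin
    partialSum (suc (suc k)) (conjugateProduct (suc k) a) a
      ≈⟨ partialSum-timesLinear (suc k) a (conjugateProduct k (a ^ p)) a ⟩
    (a - a) * s - a * conjugateProduct k (a ^ p) (suc k) * a ^ suc k
      ≈⟨ +-congˡ (-‿cong (*-congʳ (*-congˡ (conjugateProduct-degree k (a ^ p) (ℕₚ.n<1+n k))))) ⟩
    (a - a) * s - a * 0# * a ^ suc k
      ≈⟨ solve 3 (λ a s e → (a :- a) :* s :- a :* con (+ 0) :* e := con (+ 0)) refl a s (a ^ suc k) ⟩
    0# ∎
    where s = partialSum (suc k) (conjugateProduct k (a ^ p)) a

  evalMonicℤp-partialSum : ∀ {k} (cs : Vec (Fin p) k) f x → (∀ i → embed (Vec.lookup cs i) ≈ f (toℕ i)) →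
    evalMonicℤp cs x ≈ partialSum k f x + x ^ k
  evalMonicℤp-partialSum [] f x _ = sym (+-identityˡ _)
  evalMonicℤp-partialSum {suc k} (i ∷ cs) f x eq = begin
    embed i + x * evalMonicℤp cs x
      ≈⟨ +-cong (eq Fin.zero) (*-congˡ (evalMonicℤp-partialSum cs (f ∘ suc) x (eq ∘ Fin.suc))) ⟩
    f 0 + x * (partialSum k (f ∘ suc) x + x ^ k)
      ≈⟨ solve 4 (λ f x s e → f :+ x :* (s :+ e) := (f :+ x :* s) :+ x :* e) refl (f 0) x _ (x ^ k) ⟩
    (f 0 + x * partialSum k (f ∘ suc) x) + x ^ suc k
      ≈⟨ +-congʳ (partialSum-cons k f x) ⟨
    partialSum (suc k) f x + x ^ suc k ∎

  -- Double negation commutes with finite conjunctions, so the coefficients can be lifted to ℤ_p one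
  -- at a time.
  reduce-fixed : ∀ k (f : ℕ → Carrier) → (∀ n → f n ^ p ≈ f n) →
    ¬ ¬ ∃ λ (cs : Vec (Fin p) k) → ∀ i → embed (Vec.lookup cs i) ≈ f (toℕ i)
  reduce-fixed zero f fixed none = none ([] , λ ())
  reduce-fixed (suc k) f fixed none = fixed⇒prime-field (fixed 0) λ (i , eq) →
    reduce-fixed k (f ∘ suc) (fixed ∘ suc) λ (cs , eqs) →
      none (i ∷ cs , λ { Fin.zero → eq ; (Fin.suc j) → eqs j })

  periodic⇒root : ∀ {α k} → 1 ≤ k → α ^ (p ℕ.^ k) ≈ α → ¬ ¬ RootOfMonicDeg p α k
  periodic⇒root {α} {suc k} _ eq none =
    reduce-fixed (suc k) (conjugateProduct (suc k) α) (conjugateProduct-fixed {k} eq) λ (cs , eqs) →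
      none (cs , (begin
        evalMonicℤp cs α
          ≈⟨ evalMonicℤp-partialSum cs _ α eqs ⟩
        partialSum (suc k) (conjugateProduct (suc k) α) α + α ^ suc k
          ≈⟨ +-congˡ (trans (*-congʳ (conjugateProduct-monic (suc k) α)) (*-identityˡ _)) ⟨
        partialSum (suc (suc k)) (conjugateProduct (suc k) α) α
          ≈⟨ conjugateProduct-root k α ⟩
        0# ∎))

  minimal-degree-≤ : ∀ {α δ} → MinPolyDegree p α δ → ∀ {k} → 1 ≤ k → α ^ (p ℕ.^ k) ≈ α → δ ≤ k
  minimal-degree-≤ (_ , minimal) 1≤k eq = ℕₚ.≮⇒≥ λ k<δ → periodic⇒root 1≤k eq (minimal _ k<δ)

  -- The minimal polynomial yields a period k ≤ δ, and every period is the degree of some monic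
  -- polynomial over ℤ_p vanishing at α, so minimality forces k = δ.
  minimal-degree-periodic : ∀ {α δ} → MinPolyDegree p α δ → ¬ ¬ (1 ≤ δ × α ^ (p ℕ.^ δ) ≈ α)
  minimal-degree-periodic min@(root , _) none = root⇒periodic root λ (k , 1≤k , k≤δ , eq) →
    none (subst (λ j → 1 ≤ j × _ ^ (p ℕ.^ j) ≈ _) (ℕₚ.≤-antisym k≤δ (minimal-degree-≤ min 1≤k eq)) (1≤k , eq))

-- Powers of p modulo 4 and 2m

module Congruences where
  open ≡ using (refl; sym; trans)

  -- Unlike the divisibility underlying _≡ᵢ_[mod_], this record determines its arguments.
  infix 4 _≋_⟨_⟩
  record _≋_⟨_⟩ (a b : ℤ) (n : ℕ) : Set where
    constructor by
    field
      quot : ℤ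
      equality : a ≡ b ℤ.+ quot ℤ.* + n

  congruent : ∀ {a b n} → a ≡ᵢ b [mod n ] → a ≋ b ⟨ n ⟩
  congruent {a} {b} {n} n∣a-b with Signed.∣ᵤ⇒∣ {+ n} {a ℤ.- b} n∣a-b
  ... | Signed.divides q eq = by q (trans (recover a b) (cong (λ z → b ℤ.+ z) eq))
    where
    recover : ∀ a b → a ≡ b ℤ.+ (a ℤ.- b)
    recover = solve-∀

  mod-congruence : ∀ {a b n} → a ≋ b ⟨ n ⟩ → a ≡ᵢ b [mod n ]
  mod-congruence {a} {b} {n} (by q eq) = Signed.∣⇒∣ᵤ {+ n} {a ℤ.- b}
    (Signed.divides q (trans (cong (ℤ._- b) eq) (cancel b (q ℤ.* + n))))
    where
    cancel : ∀ b c → b ℤ.+ c ℤ.- b ≡ c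
    cancel = solve-∀

  ≋-reflexive : ∀ {a b n} → a ≡ b → a ≋ b ⟨ n ⟩
  ≋-reflexive {b = b} {n} refl = by (+ 0) (identity b (+ n))
    where
    identity : ∀ b n → b ≡ b ℤ.+ + 0 ℤ.* n
    identity = solve-∀

  ≋-sym : ∀ {a b n} → a ≋ b ⟨ n ⟩ → b ≋ a ⟨ n ⟩
  ≋-sym {b = b} {n} (by q refl) = by (ℤ.- q) (identity b q (+ n))
    where
    identity : ∀ b q n → b ≡ b ℤ.+ q ℤ.* n ℤ.+ ℤ.- q ℤ.* n
    identity = solve-∀

  ≋-trans : ∀ {a b c n} → a ≋ b ⟨ n ⟩ → b ≋ c ⟨ n ⟩ → a ≋ c ⟨ n ⟩
  ≋-trans {c = c} {n} (by q refl) (by r refl) = by (q ℤ.+ r) (identity c q r (+ n))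
    where
    identity : ∀ c q r n → c ℤ.+ r ℤ.* n ℤ.+ q ℤ.* n ≡ c ℤ.+ (q ℤ.+ r) ℤ.* n
    identity = solve-∀

  ≋-* : ∀ {a b c d n} → a ≋ b ⟨ n ⟩ → c ≋ d ⟨ n ⟩ → a ℤ.* c ≋ b ℤ.* d ⟨ n ⟩
  ≋-* {b = b} {d = d} {n} (by q refl) (by r refl) =
    by (b ℤ.* r ℤ.+ q ℤ.* d ℤ.+ q ℤ.* r ℤ.* + n) (identity b d q r (+ n))
    where
    identity : ∀ b d q r n → (b ℤ.+ q ℤ.* n) ℤ.* (d ℤ.+ r ℤ.* n) ≡ b ℤ.* d ℤ.+ (b ℤ.* r ℤ.+ q ℤ.* d ℤ.+ q ℤ.* r ℤ.* n) ℤ.* n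
    identity = solve-∀

  1≢3 : ∀ {x} → x ≋ + 1 ⟨ 4 ⟩ → ¬ (x ≋ + 3 ⟨ 4 ⟩)
  1≢3 x≋1 x≋3 = ℕₚ.<⇒≱ {2} {4} (s≤s (s≤s (s≤s z≤n))) (∣⇒≤ (mod-congruence (≋-trans (≋-sym x≋3) x≋1)))

  Even Odd : ℕ → Set
  Even n = ∃ λ k → n ≡ k ℕ.+ k
  Odd n = ∃ λ k → n ≡ suc (k ℕ.+ k)

  parity : ∀ n → Even n ⊎ Odd n
  parity zero = inj₁ (0 , refl)
  parity (suc n) with parity n
  ... | inj₁ (k , refl) = inj₂ (k , refl)
  ... | inj₂ (k , refl) = inj₁ (suc k , cong suc (sym (ℕₚ.+-suc k k)))

  ¬even-odd : ∀ {n} → Even n → ¬ Odd n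
  ¬even-odd (zero , refl) (_ , ())
  ¬even-odd (suc k , refl) (zero , eq) with trans (sym (ℕₚ.+-suc k k)) (ℕₚ.suc-injective eq)
  ... | ()
  ¬even-odd (suc k , refl) (suc l , eq) = ¬even-odd (k , refl) (l , ℕₚ.suc-injective
    (trans (sym (ℕₚ.+-suc k k)) (trans (ℕₚ.suc-injective eq) (cong suc (ℕₚ.+-suc l l)))))

  double-injective : ∀ a b → a ℕ.+ a ≡ b ℕ.+ b → a ≡ b
  double-injective zero zero _ = refl
  double-injective (suc a) (suc b) eq = cong suc (double-injective a b (ℕₚ.suc-injective
    (trans (sym (ℕₚ.+-suc a a)) (trans (ℕₚ.suc-injective eq) (ℕₚ.+-suc b b)))))

  half-double : ∀ v → (v ℕ.+ v) / 2 ≡ v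
  half-double v = trans (cong (_/ 2) (trans (cong (v ℕ.+_) (sym (ℕₚ.+-identityʳ v))) (ℕₚ.*-comm 2 v))) (m*n/n≡m v 2)

  even-from-mod2 : ∀ u → + u ≡ᵢ + 0 [mod 2 ] → Even u
  even-from-mod2 u 2∣u with subst (2 ∣_) (cong ℤ.∣_∣ (ℤₚ.+-identityʳ (+ u))) 2∣u
  ... | divides q eq = q , trans eq (trans (ℕₚ.*-comm q 2) (cong (q ℕ.+_) (ℕₚ.+-identityʳ q)))

  odd-from-mod2 : ∀ u → + u ≡ᵢ + 1 [mod 2 ] → Odd u
  odd-from-mod2 zero (divides zero ())
  odd-from-mod2 zero (divides (suc q) ())
  odd-from-mod2 (suc n) 2∣ = let k , eq = even-from-mod2 n (subst (2 ∣_) (cong ℤ.∣_∣ (trans (ℤₚ.⊖-≥ {suc n} {1} (s≤s z≤n)) (sym (ℤₚ.+-identityʳ (+ n))))) 2∣)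
    in k , cong suc eq

  doubly-even-from-mod4 : ∀ u → + u ≡ᵢ + 0 [mod 4 ] → ∃ λ v → u ≡ v ℕ.+ v × Even v
  doubly-even-from-mod4 u 4∣u with subst (4 ∣_) (cong ℤ.∣_∣ (ℤₚ.+-identityʳ (+ u))) 4∣u
  ... | divides q eq = q ℕ.+ q , trans eq (identity q) , q , refl
    where
    identity : ∀ q → q ℕ.* 4 ≡ (q ℕ.+ q) ℕ.+ (q ℕ.+ q)
    identity = ℕ-Solver.solve-∀

  singly-even-from-mod4 : ∀ u → + u ≡ᵢ + 2 [mod 4 ] → ∃ λ v → u ≡ v ℕ.+ v × Odd v
  singly-even-from-mod4 zero 4∣ = ⊥-elim (ℕₚ.<⇒≱ (s≤s (s≤s (s≤s z≤n))) (∣⇒≤ 4∣))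
  singly-even-from-mod4 (suc zero) 4∣ = ⊥-elim (ℕₚ.<⇒≱ (s≤s (s≤s z≤n)) (∣⇒≤ 4∣))
  singly-even-from-mod4 (suc (suc n)) 4∣ =
    let v , eq , k , eq′ = doubly-even-from-mod4 n (subst (4 ∣_) (cong ℤ.∣_∣ (trans (ℤₚ.⊖-≥ {suc (suc n)} {2} (s≤s (s≤s z≤n))) (sym (ℤₚ.+-identityʳ (+ n))))) 4∣)
    in suc v , trans (cong (λ k → suc (suc k)) eq) (cong suc (sym (ℕₚ.+-suc v v))) , k , cong suc eq′

  module PeriodArithmetic (p m u : ℕ) (m≥3 : 3 ≤ m) (order : IsOrderMod p (2 ℕ.* m) u) where

    P : ℕ → ℤ
    P k = + (p ℕ.^ k)

    -- The arithmetic counterpart of α^(p^k) = α. No field occurs in this module; `fixed⇒periodic`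
    -- and `periodic⇒fixed` make the connection.
    Periodic : ℕ → Set
    Periodic k =
      (P k ≡ᵢ + 1 [mod 4 ] × (P k ≡ᵢ + 1 [mod 2 ℕ.* m ] ⊎ P k ≡ᵢ ℤ.- + 1 [mod 2 ℕ.* m ])) ⊎
      (P k ≡ᵢ + 3 [mod 4 ] × (P k ≡ᵢ + (m ℕ.+ 1) [mod 2 ℕ.* m ] ⊎ P k ≡ᵢ + (m ∸ 1) [mod 2 ℕ.* m ]))

    private
      1≤u : 1 ≤ u
      1≤u = proj₁ order

      Pu≋1 : P u ≋ + 1 ⟨ 2 ℕ.* m ⟩
      Pu≋1 = congruent (proj₁ (proj₂ order))

      P-+ : ∀ i j → P (i ℕ.+ j) ≡ P i ℤ.* P j
      P-+ i j = trans (cong +_ (ℕₚ.^-distribˡ-+-* p i j)) (ℤₚ.pos-* (p ℕ.^ i) (p ℕ.^ j))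

      P-cong : ∀ {i j n} → i ≡ j → P i ≋ P j ⟨ n ⟩
      P-cong eq = ≋-reflexive (cong P eq)

      P-suc : ∀ k → P (suc k) ≡ + p ℤ.* P k
      P-suc k = ℤₚ.pos-* p (p ℕ.^ k)

      P-1 : P 1 ≡ + p
      P-1 = cong +_ (ℕₚ.*-identityʳ p)

      P-period : ∀ {n} t → P t ≋ + 1 ⟨ n ⟩ → ∀ a j → P (a ℕ.+ j ℕ.* t) ≋ P a ⟨ n ⟩
      P-period {n} t Pt a j = ≋-trans (≋-reflexive (P-+ a (j ℕ.* t)))
        (≋-trans (≋-* (≋-reflexive {P a} refl) (go j)) (≋-reflexive (ℤₚ.*-identityʳ (P a))))
        where
        go : ∀ j → P (j ℕ.* t) ≋ + 1 ⟨ n ⟩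
        go zero = ≋-reflexive refl
        go (suc j) = ≋-trans (≋-reflexive (P-+ t (j ℕ.* t))) (≋-* Pt (go j))

      order-divides : ∀ k → P k ≋ + 1 ⟨ 2 ℕ.* m ⟩ → u ∣ k
      order-divides k Pk = m%n≡0⇒n∣m k u (minimal (k % u) (m%n<n k u)
          (≋-trans (≋-sym (P-period u Pu≋1 (k % u) (k / u))) (≋-trans (P-cong (sym (m≡m%n+[m/n]*n k u))) Pk)))
        where
        instance _ = ℕ.>-nonZero 1≤u
        minimal : ∀ r → r < u → P r ≋ + 1 ⟨ 2 ℕ.* m ⟩ → r ≡ 0
        minimal zero _ _ = refl
        minimal (suc r) r<u eq = ⊥-elim (proj₂ (proj₂ order) (suc r) (s≤s z≤n) r<u (mod-congruence eq))

      -- Since c² ≡ 1, u divides 2k. The quotient is odd: an even one would make k a multiple of u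
      -- and c ≡ 1. With quotient 2j + 1, the number v = k - ju is half of u.
      half-period : ∀ k {c} → P k ≋ c ⟨ 2 ℕ.* m ⟩ → c ℤ.* c ≋ + 1 ⟨ 2 ℕ.* m ⟩ → ¬ (c ≋ + 1 ⟨ 2 ℕ.* m ⟩) →
        ∃ λ v → u ≡ v ℕ.+ v × (∃ λ j → k ≡ v ℕ.+ j ℕ.* u) × P v ≋ c ⟨ 2 ℕ.* m ⟩
      half-period k {c} Pk c² c≢1
        with order-divides (k ℕ.+ k) (≋-trans (≋-reflexive (P-+ k k)) (≋-trans (≋-* Pk Pk) c²))
      ... | divides q eq with parity q
      ...   | inj₁ (j , refl) = ⊥-elim (c≢1 (≋-trans (≋-sym Pk)
                (≋-trans (P-cong (double-injective k (j ℕ.* u) (trans eq (ℕₚ.*-distribʳ-+ u j j)))) (P-period u Pu≋1 0 j))))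
      ...   | inj₂ (j , refl) = v , u≡ , (j , k≡) ,
                ≋-trans (≋-sym (P-period u Pu≋1 v j)) (≋-trans (P-cong (sym k≡)) Pk)
        where
        ju = j ℕ.* u
        eq′ : k ℕ.+ k ≡ u ℕ.+ (ju ℕ.+ ju)
        eq′ = trans eq (cong (u ℕ.+_) (ℕₚ.*-distribʳ-+ u j j))
        ju≤k : ju ≤ k
        ju≤k = ℕₚ.≮⇒≥ λ k<ju → ℕₚ.<⇒≱ (ℕₚ.+-mono-< k<ju k<ju) (subst (ju ℕ.+ ju ≤_) (sym eq′) (ℕₚ.m≤n+m _ u))
        v = k ∸ ju
        k≡ : k ≡ v ℕ.+ ju
        k≡ = sym (ℕₚ.m∸n+n≡m ju≤k)
        u≡ : u ≡ v ℕ.+ v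
        u≡ = ℕₚ.+-cancelʳ-≡ (ju ℕ.+ ju) u (v ℕ.+ v) (trans (sym eq′) (trans (cong₂ ℕ._+_ k≡ k≡) (rearrange v ju)))
          where
          rearrange : ∀ v w → (v ℕ.+ w) ℕ.+ (v ℕ.+ w) ≡ (v ℕ.+ v) ℕ.+ (w ℕ.+ w)
          rearrange = ℕ-Solver.solve-∀

      too-small : ∀ {k} → 1 ≤ k → k < 2 ℕ.* m → ¬ (2 ℕ.* m ∣ k)
      too-small 1≤k k<2m 2m∣k = ℕₚ.<⇒≱ k<2m (∣⇒≤ {{ℕ.>-nonZero 1≤k}} 2m∣k)

      m<2m : m < 2 ℕ.* m
      m<2m = ℕₚ.m<m+n m (ℕₚ.<-≤-trans (s≤s z≤n) (ℕₚ.≤-trans m≥3 (ℕₚ.m≤m+n m 0)))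

      -1≢1 : ¬ (ℤ.- + 1 ≋ + 1 ⟨ 2 ℕ.* m ⟩)
      -1≢1 eq = too-small (s≤s z≤n) (ℕₚ.<-trans m≥3 m<2m) (mod-congruence eq)

      m+1≢1 : ¬ (+ (m ℕ.+ 1) ≋ + 1 ⟨ 2 ℕ.* m ⟩)
      m+1≢1 eq = too-small (ℕₚ.≤-trans (s≤s z≤n) m≥3) m<2m
        (subst (2 ℕ.* m ∣_) (cong ℤ.∣_∣ (cancel (+ m))) (mod-congruence eq))
        where
        cancel : ∀ m → m ℤ.+ + 1 ℤ.- + 1 ≡ m
        cancel = solve-∀

      m-1≡ : + (m ∸ 1) ≡ + m ℤ.- + 1
      m-1≡ = sym (ℤₚ.⊖-≥ {m} {1} (ℕₚ.≤-trans (s≤s z≤n) m≥3))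

      m-1≢1 : ¬ (+ (m ∸ 1) ≋ + 1 ⟨ 2 ℕ.* m ⟩)
      m-1≢1 eq = too-small (ℕₚ.m<n⇒0<n∸m m≥3) (ℕₚ.≤-<-trans (ℕₚ.m∸n≤m m 2) m<2m)
        (subst (2 ℕ.* m ∣_) (cong ℤ.∣_∣ (trans (cong (ℤ._- + 1) m-1≡) (trans (combine (+ m)) (ℤₚ.⊖-≥ {m} {2} (ℕₚ.≤-trans (s≤s (s≤s z≤n)) m≥3)))))
          (mod-congruence eq))
        where
        combine : ∀ m → m ℤ.- + 1 ℤ.- + 1 ≡ m ℤ.- + 2
        combine = solve-∀

      -- Here e = ±1 and (m + e)² = e² + (m + 2e) m. The last product is a multiple of 2m because m
      -- is even: x and e are odd and x ≡ m + e modulo 2m. The number f witnesses that e is odd.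
      m±1-squared : ∀ {x} e → e ℤ.* e ≡ + 1 → x ≋ + 3 ⟨ 4 ⟩ → x ≋ + m ℤ.+ e ⟨ 2 ℕ.* m ⟩ →
        (∃ λ f → + 1 ≡ e ℤ.+ + 2 ℤ.* f) → (+ m ℤ.+ e) ℤ.* (+ m ℤ.+ e) ≋ + 1 ⟨ 2 ℕ.* m ⟩
      m±1-squared e e² (by a refl) (by b eq) (f , eqf) = by (h ℤ.+ e) (begin
        (+ m ℤ.+ e) ℤ.* (+ m ℤ.+ e)               ≡⟨ expand (+ m) e ⟩
        e ℤ.* e ℤ.+ (+ m ℤ.+ + 2 ℤ.* e) ℤ.* + m    ≡⟨ cong₂ ℤ._+_ e² (cong (λ z → (z ℤ.+ + 2 ℤ.* e) ℤ.* + m) m≡2h) ⟩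
        + 1 ℤ.+ (+ 2 ℤ.* h ℤ.+ + 2 ℤ.* e) ℤ.* + m   ≡⟨ factor h e (+ m) ⟩
        + 1 ℤ.+ (h ℤ.+ e) ℤ.* (+ 2 ℤ.* + m)       ≡⟨ cong (λ z → + 1 ℤ.+ (h ℤ.+ e) ℤ.* z) (ℤₚ.pos-* 2 m) ⟨
        + 1 ℤ.+ (h ℤ.+ e) ℤ.* + (2 ℕ.* m)         ∎)
        where
        open ≡-Reasoning
        -- Half of m, found by solving 3 + 4a = m + e + 2bm for m and writing 3 as 2 + (e + 2f).
        h = + 1 ℤ.+ f ℤ.+ + 2 ℤ.* a ℤ.- b ℤ.* + m
        expand : ∀ m e → (m ℤ.+ e) ℤ.* (m ℤ.+ e) ≡ e ℤ.* e ℤ.+ (m ℤ.+ + 2 ℤ.* e) ℤ.* m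
        expand = solve-∀
        factor : ∀ h e m → + 1 ℤ.+ (+ 2 ℤ.* h ℤ.+ + 2 ℤ.* e) ℤ.* m ≡ + 1 ℤ.+ (h ℤ.+ e) ℤ.* (+ 2 ℤ.* m)
        factor = solve-∀
        isolate : ∀ m e b n → m ≡ (m ℤ.+ e ℤ.+ b ℤ.* n) ℤ.- e ℤ.- b ℤ.* n
        isolate = solve-∀
        split : ∀ a e b m f → (+ 2 ℤ.+ (e ℤ.+ + 2 ℤ.* f) ℤ.+ a ℤ.* + 4) ℤ.- e ℤ.- b ℤ.* (+ 2 ℤ.* m)
          ≡ + 2 ℤ.* (+ 1 ℤ.+ f ℤ.+ + 2 ℤ.* a ℤ.- b ℤ.* m)
        split = solve-∀
        m≡2h : + m ≡ + 2 ℤ.* h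
        m≡2h = begin
          + m                                                       ≡⟨ isolate (+ m) e b (+ (2 ℕ.* m)) ⟩
          (+ m ℤ.+ e ℤ.+ b ℤ.* + (2 ℕ.* m)) ℤ.- e ℤ.- b ℤ.* + (2 ℕ.* m)
            ≡⟨ cong₂ (λ y z → y ℤ.- e ℤ.- b ℤ.* z) (sym eq) (ℤₚ.pos-* 2 m) ⟩
          (+ 2 ℤ.+ + 1 ℤ.+ a ℤ.* + 4) ℤ.- e ℤ.- b ℤ.* (+ 2 ℤ.* + m)
            ≡⟨ cong (λ y → (+ 2 ℤ.+ y ℤ.+ a ℤ.* + 4) ℤ.- e ℤ.- b ℤ.* (+ 2 ℤ.* + m)) eqf ⟩
          (+ 2 ℤ.+ (e ℤ.+ + 2 ℤ.* f) ℤ.+ a ℤ.* + 4) ℤ.- e ℤ.- b ℤ.* (+ 2 ℤ.* + m)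
            ≡⟨ split a e b (+ m) f ⟩
          + 2 ℤ.* h                                                 ∎

      -- A periodic k is a multiple of u, or u/2 plus a multiple of u. In the second case the
      -- congruence for p^k modulo 2m descends to p^(u/2), where the hypotheses of the theorem can
      -- contradict it.
      data Shape (k : ℕ) : Set where
        full : P k ≋ + 1 ⟨ 4 ⟩ → u ∣ k → Shape k
        half₁ : ∀ {v} → P k ≋ + 1 ⟨ 4 ⟩ → u ≡ v ℕ.+ v → (∃ λ j → k ≡ v ℕ.+ j ℕ.* u) →
          P v ≡ᵢ ℤ.- + 1 [mod 2 ℕ.* m ] → Shape k
        half₃ : ∀ {v} → P k ≋ + 3 ⟨ 4 ⟩ → u ≡ v ℕ.+ v → (∃ λ j → k ≡ v ℕ.+ j ℕ.* u) →
          P v ≡ᵢ + (m ℕ.+ 1) [mod 2 ℕ.* m ] ⊎ P v ≡ᵢ + (m ∸ 1) [mod 2 ℕ.* m ] → Shape k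

      shape : ∀ k → Periodic k → Shape k
      shape k (inj₁ (mod4 , inj₁ eq)) = full (congruent mod4) (order-divides k (congruent eq))
      shape k (inj₁ (mod4 , inj₂ eq)) =
        let v , u≡ , j , Pv = half-period k (congruent eq) (≋-reflexive refl) -1≢1
        in half₁ (congruent mod4) u≡ j (mod-congruence Pv)
      shape k (inj₂ (mod4 , inj₁ eq)) =
        let v , u≡ , j , Pv = half-period k (congruent eq)
              (m±1-squared {P k} (+ 1) refl (congruent mod4) (congruent {b = + (m ℕ.+ 1)} eq) (+ 0 , refl)) m+1≢1
        in half₃ (congruent mod4) u≡ j (inj₁ (mod-congruence Pv))
      shape k (inj₂ (mod4 , inj₂ eq)) =
        let v , u≡ , j , Pv = half-period k (congruent eq)
              (subst (λ c → c ℤ.* c ≋ + 1 ⟨ 2 ℕ.* m ⟩) (sym m-1≡) (m±1-squared {P k} (ℤ.- + 1) refl (congruent mod4)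
                (≋-trans (congruent eq) (≋-reflexive m-1≡)) (+ 1 , refl))) m-1≢1
        in half₃ (congruent mod4) u≡ j (inj₂ (mod-congruence Pv))

      P≋1 : + p ≋ + 1 ⟨ 4 ⟩ → ∀ k → P k ≋ + 1 ⟨ 4 ⟩
      P≋1 p≋1 zero = ≋-reflexive refl
      P≋1 p≋1 (suc k) = ≋-trans (≋-reflexive (P-suc k)) (≋-* p≋1 (P≋1 p≋1 k))

      P-even : + p ≋ + 3 ⟨ 4 ⟩ → ∀ {k} → Even k → P k ≋ + 1 ⟨ 4 ⟩
      P-even p≋3 (j , refl) = ≋-trans (P-cong (sym (identity j))) (P-period 2 P2 0 j)
        where
        identity : ∀ j → j ℕ.* 2 ≡ j ℕ.+ j
        identity = ℕ-Solver.solve-∀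
        P2 : P 2 ≋ + 1 ⟨ 4 ⟩
        P2 = ≋-trans (≋-reflexive (trans (P-suc 1) (cong (+ p ℤ.*_) P-1))) (≋-trans (≋-* p≋3 p≋3) (by (+ 2) refl))

      P-odd : + p ≋ + 3 ⟨ 4 ⟩ → ∀ {k} → Odd k → P k ≋ + 3 ⟨ 4 ⟩
      P-odd p≋3 (j , refl) = ≋-trans (≋-reflexive (P-suc (j ℕ.+ j))) (≋-* p≋3 (P-even p≋3 (j , refl)))

      multiple-≥ : ∀ {k} → 1 ≤ k → u ∣ k → u ≤ k
      multiple-≥ 1≤k = ∣⇒≤ {{ℕ.>-nonZero 1≤k}}

      half-≥ : ∀ {k} v w → u ≡ v ℕ.+ v → u ≡ w ℕ.+ w → (∃ λ j → k ≡ w ℕ.+ j ℕ.* u) → v ≤ k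
      half-≥ v w u≡v u≡w (j , refl) =
        ℕₚ.≤-trans (ℕₚ.≤-reflexive (double-injective v w (trans (sym u≡v) u≡w))) (ℕₚ.m≤m+n w (j ℕ.* u))

    module _ {δ} (1≤δ : 1 ≤ δ) (periodic : Periodic δ) (minimal : ∀ {k} → 1 ≤ k → Periodic k → δ ≤ k) where
      private
        -- Every shape is at least u/2, so where the degree is u/2 only the periodicity of u/2
        -- remains to be checked.
        δ≥half : ∀ {v} → u ≡ v ℕ.+ v → v ≤ δ
        δ≥half {v} u≡ with shape δ periodic
        ... | full _ u∣δ = ℕₚ.≤-trans (subst (v ≤_) (sym u≡) (ℕₚ.m≤m+n v v)) (multiple-≥ 1≤δ u∣δ)
        ... | half₁ {w} _ u≡w k≡ _ = half-≥ v w u≡ u≡w k≡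
        ... | half₃ {w} _ u≡w k≡ _ = half-≥ v w u≡ u≡w k≡

        1≤half : ∀ v → u ≡ v ℕ.+ v → 1 ≤ v
        1≤half zero u≡0 = subst (1 ≤_) u≡0 1≤u
        1≤half (suc v) _ = s≤s z≤n

        δ≡half : ∀ v → u ≡ v ℕ.+ v → Periodic v → δ ≡ v
        δ≡half v u≡ per = ℕₚ.≤-antisym (minimal (1≤half v u≡) per) (δ≥half u≡)

        half≡ : ∀ v → u ≡ v ℕ.+ v → u / 2 ≡ v
        half≡ v u≡ = trans (cong (_/ 2) u≡) (half-double v)

        same-half : ∀ v w → u ≡ v ℕ.+ v → u ≡ w ℕ.+ w → v ≡ w
        same-half v w u≡v u≡w = double-injective v w (trans (sym u≡v) u≡w)

        δ≡u : P u ≋ + 1 ⟨ 4 ⟩ → u ≤ δ → δ ≡ u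
        δ≡u Pu u≤δ = ℕₚ.≤-antisym (minimal 1≤u (inj₁ (mod-congruence Pu , inj₁ (mod-congruence Pu≋1)))) u≤δ

      degree-1-half : + p ≡ᵢ + 1 [mod 4 ] × + u ≡ᵢ + 0 [mod 2 ] × P (u / 2) ≡ᵢ ℤ.- + 1 [mod 2 ℕ.* m ] → δ ≡ u / 2
      degree-1-half (p≡1 , u≡0 , eq) with even-from-mod2 u u≡0
      ... | v , u≡ rewrite half≡ v u≡ = δ≡half v u≡ (inj₁ (mod-congruence (P≋1 (congruent p≡1) v) , inj₂ eq))

      degree-3-0-half : + p ≡ᵢ + 3 [mod 4 ] × + u ≡ᵢ + 0 [mod 4 ] × P (u / 2) ≡ᵢ ℤ.- + 1 [mod 2 ℕ.* m ] → δ ≡ u / 2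
      degree-3-0-half (p≡3 , u≡0 , eq) with doubly-even-from-mod4 u u≡0
      ... | v , u≡ , even rewrite half≡ v u≡ = δ≡half v u≡ (inj₁ (mod-congruence (P-even (congruent p≡3) even) , inj₂ eq))

      degree-3-2-half : + p ≡ᵢ + 3 [mod 4 ] × + u ≡ᵢ + 2 [mod 4 ]
        × (P (u / 2) ≡ᵢ + (m ℕ.+ 1) [mod 2 ℕ.* m ] ⊎ P (u / 2) ≡ᵢ + (m ∸ 1) [mod 2 ℕ.* m ]) → δ ≡ u / 2
      degree-3-2-half (p≡3 , u≡2 , eq) with singly-even-from-mod4 u u≡2
      ... | v , u≡ , odd rewrite half≡ v u≡ = δ≡half v u≡ (inj₂ (mod-congruence (P-odd (congruent p≡3) odd) , eq))

      degree-1-full : + p ≡ᵢ + 1 [mod 4 ] × + u ≡ᵢ + 0 [mod 2 ] × ¬ (P (u / 2) ≡ᵢ ℤ.- + 1 [mod 2 ℕ.* m ]) → δ ≡ u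
      degree-1-full (p≡1 , _ , neq) with shape δ periodic
      ... | full _ u∣δ = δ≡u (P≋1 (congruent p≡1) u) (multiple-≥ 1≤δ u∣δ)
      ... | half₁ {w} _ u≡ _ eq = ⊥-elim (neq (subst (λ v → P v ≡ᵢ ℤ.- + 1 [mod 2 ℕ.* m ]) (sym (half≡ w u≡)) eq))
      ... | half₃ Pδ _ _ _ = ⊥-elim (1≢3 (P≋1 (congruent p≡1) δ) Pδ)

      degree-1-odd : + p ≡ᵢ + 1 [mod 4 ] × + u ≡ᵢ + 1 [mod 2 ] → δ ≡ u
      degree-1-odd (p≡1 , u≡1) with shape δ periodic
      ... | full _ u∣δ = δ≡u (P≋1 (congruent p≡1) u) (multiple-≥ 1≤δ u∣δ)
      ... | half₁ {w} _ u≡ _ _ = ⊥-elim (¬even-odd (w , u≡) (odd-from-mod2 u u≡1))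
      ... | half₃ {w} _ u≡ _ _ = ⊥-elim (¬even-odd (w , u≡) (odd-from-mod2 u u≡1))

      degree-3-0-full : + p ≡ᵢ + 3 [mod 4 ] × + u ≡ᵢ + 0 [mod 4 ] × ¬ (P (u / 2) ≡ᵢ ℤ.- + 1 [mod 2 ℕ.* m ]) → δ ≡ u
      degree-3-0-full (p≡3 , u≡0 , neq) with shape δ periodic | doubly-even-from-mod4 u u≡0
      ... | full _ u∣δ | v , u≡ , _ = δ≡u (P-even (congruent p≡3) (v , u≡)) (multiple-≥ 1≤δ u∣δ)
      ... | half₁ {w} _ u≡ _ eq | _ = ⊥-elim (neq (subst (λ v → P v ≡ᵢ ℤ.- + 1 [mod 2 ℕ.* m ]) (sym (half≡ w u≡)) eq))
      -- δ = w + ju has the parity of w = u/2, which is even because 4 divides u; hence p^δ ≡ 1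
      -- modulo 4.
      ... | half₃ {w} Pδ u≡w (j , refl) _ | v , u≡v , even = ⊥-elim (1≢3
              (≋-trans (P-period u (P-even (congruent p≡3) (v , u≡v)) w j)
                (P-even (congruent p≡3) (subst Even (same-half v w u≡v u≡w) even))) Pδ)

      degree-3-2-full : + p ≡ᵢ + 3 [mod 4 ] × + u ≡ᵢ + 2 [mod 4 ]
        × ¬ (P (u / 2) ≡ᵢ + (m ℕ.+ 1) [mod 2 ℕ.* m ] ⊎ P (u / 2) ≡ᵢ + (m ∸ 1) [mod 2 ℕ.* m ]) → δ ≡ u
      degree-3-2-full (p≡3 , u≡2 , neq) with shape δ periodic | singly-even-from-mod4 u u≡2
      ... | full _ u∣δ | v , u≡ , _ = δ≡u (P-even (congruent p≡3) (v , u≡)) (multiple-≥ 1≤δ u∣δ)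
      -- Now w = u/2 is odd, so δ = w + ju is odd and p^δ ≡ 3 modulo 4.
      ... | half₁ {w} Pδ u≡w (j , refl) _ | v , u≡v , odd = ⊥-elim (1≢3 Pδ
              (≋-trans (P-period u (P-even (congruent p≡3) (v , u≡v)) w j)
                (P-odd (congruent p≡3) (subst Odd (same-half v w u≡v u≡w) odd))))
      ... | half₃ {w} _ u≡ _ eq | _ = ⊥-elim (neq (subst
              (λ v → P v ≡ᵢ + (m ℕ.+ 1) [mod 2 ℕ.* m ] ⊎ P v ≡ᵢ + (m ∸ 1) [mod 2 ℕ.* m ]) (sym (half≡ w u≡)) eq))

      -- For odd u the half shapes disappear and δ is a multiple of u. Odd multiples give p^δ ≡ 3
      -- modulo 4, which the shape `full` forbids, so 2u is the least one left.
      degree-3-odd : + p ≡ᵢ + 3 [mod 4 ] × + u ≡ᵢ + 1 [mod 2 ] → δ ≡ 2 ℕ.* u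
      degree-3-odd (p≡3 , u≡1) = trans (ℕₚ.≤-antisym
          (minimal (ℕₚ.≤-trans 1≤u (ℕₚ.m≤m+n u u)) (inj₁ (mod-congruence P2u , inj₁ (mod-congruence
            (≋-trans (≋-reflexive (P-+ u u)) (≋-* Pu≋1 Pu≋1)))))) lower)
          (cong (u ℕ.+_) (sym (ℕₚ.+-identityʳ u)))
        where
        odd = odd-from-mod2 u u≡1
        P2u : P (u ℕ.+ u) ≋ + 1 ⟨ 4 ⟩
        P2u = P-even (congruent p≡3) (u , refl)
        lower : u ℕ.+ u ≤ δ
        lower with shape δ periodic
        ... | half₁ {w} _ u≡ _ _ = ⊥-elim (¬even-odd (w , u≡) odd)
        ... | half₃ {w} _ u≡ _ _ = ⊥-elim (¬even-odd (w , u≡) odd)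
        ... | full Pδ (divides q refl) with parity q
        ...   | inj₁ (zero , refl) = ⊥-elim (ℕₚ.<-irrefl refl 1≤δ)
        ...   | inj₁ (suc j , refl) = subst (u ℕ.+ u ≤_) (sym (identity j u)) (ℕₚ.m≤m+n (u ℕ.+ u) _)
          where
          identity : ∀ j u → (suc j ℕ.+ suc j) ℕ.* u ≡ (u ℕ.+ u) ℕ.+ (j ℕ.+ j) ℕ.* u
          identity = ℕ-Solver.solve-∀
        ...   | inj₂ (j , refl) = ⊥-elim (1≢3 Pδ (≋-trans (P-cong (identity j u))
                (≋-trans (P-period (u ℕ.+ u) P2u u j) (P-odd (congruent p≡3) odd))))
          where
          identity : ∀ j u → suc (j ℕ.+ j) ℕ.* u ≡ u ℕ.+ j ℕ.* (u ℕ.+ u)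
          identity = ℕ-Solver.solve-∀

open Congruences

-- The conjugates of ζ₄ (ζ^s + ζ^(−s))

even⇒2∣ : ∀ {n} → Even n → 2 ∣ n
even⇒2∣ (k , ≡.refl) = divides k (identity k)
  where
  identity : ∀ k → k ℕ.+ k ≡ k ℕ.* 2
  identity = ℕ-Solver.solve-∀

2∣⇒even : ∀ {n} → 2 ∣ n → Even n
2∣⇒even (divides k ≡.refl) = k , identity k
  where
  identity : ∀ k → k ℕ.* 2 ≡ k ℕ.+ k
  identity = ℕ-Solver.solve-∀

odd-prime : ∀ {p} → Prime p → 2 < p → Odd p
odd-prime {p} pp 2<p with parity p
... | inj₂ odd = odd
... | inj₁ even with prime⇒irreducible pp (even⇒2∣ even)
...   | inj₂ 2≡p = ⊥-elim (ℕₚ.<⇒≢ 2<p 2≡p)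

odd-power : ∀ {p} → Odd p → ∀ k → Odd (p ℕ.^ k)
odd-power odd zero = 0 , ≡.refl
odd-power {p} (a , ≡.refl) (suc k) with odd-power {p} (a , ≡.refl) k
... | b , eq = a ℕ.+ b ℕ.+ (a ℕ.+ a) ℕ.* b , ≡.trans (cong (p ℕ.*_) eq) (identity a b)
  where
  identity : ∀ a b → suc (a ℕ.+ a) ℕ.* suc (b ℕ.+ b)
    ≡ suc ((a ℕ.+ b ℕ.+ (a ℕ.+ a) ℕ.* b) ℕ.+ (a ℕ.+ b ℕ.+ (a ℕ.+ a) ℕ.* b))
  identity = ℕ-Solver.solve-∀

coprime-2m : ∀ {p m} → Prime p → 2 < p → Coprime p m → Coprime (2 ℕ.* m) p
coprime-2m {p} {m} pp 2<p cop (d∣2m , d∣p) with prime⇒irreducible pp d∣p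
... | inj₁ d≡1 = d≡1
... | inj₂ ≡.refl with euclidsLemma 2 m pp d∣2m
...   | inj₁ p∣2 = ⊥-elim (ℕₚ.<⇒≱ 2<p (∣⇒≤ p∣2))
...   | inj₂ p∣m = cop (∣-refl , p∣m)

-- The factor n may share the prime 2 with 2m. Writing x = 2y removes that prime from both sides,
-- and n is coprime to what remains.
divides-cofactor : ∀ {n m x} → Coprime n m → Even x → 2 ℕ.* m ∣ n ℕ.* x → 2 ℕ.* m ∣ x
divides-cofactor {n} {m} cop (y , ≡.refl) 2m∣ = subst (2 ℕ.* m ∣_) (double y) (*-monoʳ-∣ 2
  (coprime-divisor (Coprimality.sym cop) (*-cancelˡ-∣ 2 (subst (2 ℕ.* m ∣_) (factor n y) 2m∣))))
  where
  factor : ∀ n y → n ℕ.* (y ℕ.+ y) ≡ 2 ℕ.* (n ℕ.* y)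
  factor = ℕ-Solver.solve-∀
  double : ∀ y → 2 ℕ.* y ≡ y ℕ.+ y
  double = ℕ-Solver.solve-∀

module _ {n m x} (cop : Coprime n m) (even : Even x) where
  private
    odd-cofactor : 2 ∣ m → Odd n
    odd-cofactor 2∣m with parity n
    ... | inj₂ odd = odd
    ... | inj₁ evenⁿ with cop (even⇒2∣ evenⁿ , 2∣m)
    ...   | ()

    -- For even m, coprimality makes n odd, so nm ≡ m modulo 2m and n(x + m) ≡ nx + m. Both lemmas
    -- below obtain 2 ∣ m from their divisibility hypothesis and the evenness of x.
    2∣m⇒shift : 2 ∣ m → ∃ λ r → n ℕ.* (x ℕ.+ m) ≡ r ℕ.* (2 ℕ.* m) ℕ.+ (n ℕ.* x ℕ.+ m)
    2∣m⇒shift 2∣m with odd-cofactor 2∣m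
    ... | r , ≡.refl = r , identity r x m
      where
      identity : ∀ r x m → suc (r ℕ.+ r) ℕ.* (x ℕ.+ m) ≡ r ℕ.* (2 ℕ.* m) ℕ.+ (suc (r ℕ.+ r) ℕ.* x ℕ.+ m)
      identity = ℕ-Solver.solve-∀

  divides-cofactor-+ : 2 ℕ.* m ∣ n ℕ.* x ℕ.+ m → 2 ℕ.* m ∣ x ℕ.+ m
  divides-cofactor-+ 2m∣ =
    let 2∣m = ∣m+n∣m⇒∣n (∣-trans (m∣m*n m) 2m∣) (∣n⇒∣m*n n (even⇒2∣ even))
        r , eq = 2∣m⇒shift 2∣m
    in divides-cofactor cop (2∣⇒even (∣m∣n⇒∣m+n (even⇒2∣ even) 2∣m))
         (subst (2 ℕ.* m ∣_) (≡.sym eq) (∣m∣n⇒∣m+n (n∣m*n r) 2m∣))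

  divides-+-cofactor : 2 ℕ.* m ∣ x ℕ.+ m → 2 ℕ.* m ∣ n ℕ.* x ℕ.+ m
  divides-+-cofactor 2m∣ =
    let r , eq = 2∣m⇒shift (∣m+n∣m⇒∣n (∣-trans (m∣m*n m) 2m∣) (even⇒2∣ even))
    in ∣m+n∣m⇒∣n (subst (2 ℕ.* m ∣_) eq (∣n⇒∣m*n n 2m∣)) (n∣m*n r)

module _ (a b : ℤ) {c N} (e : ℤ) (eq : a ℤ.- b ≡ + c ℤ.+ e ℤ.* + N) where

  -- The multiple of N replaces the possibly negative difference a - b by a natural number c, which
  -- can serve as an exponent of a root of unity.
  divides⇒congruent : N ∣ c → a ≡ᵢ b [mod N ]
  divides⇒congruent (divides q ≡.refl) = Signed.∣⇒∣ᵤ {+ N} {a ℤ.- b} (Signed.divides (+ q ℤ.+ e)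
    (≡.trans eq (≡.trans (cong (λ z → z ℤ.+ e ℤ.* + N) (ℤₚ.pos-* q N)) (≡.sym (ℤₚ.*-distribʳ-+ (+ N) (+ q) e)))))

  congruent⇒divides : a ≡ᵢ b [mod N ] → N ∣ c
  congruent⇒divides cong-ab with Signed.∣ᵤ⇒∣ {+ N} {a ℤ.- b} cong-ab
  ... | Signed.divides q eq′ = Signed.∣⇒∣ᵤ {+ N} {+ c} (Signed.divides (q ℤ.- e)
    (≡.trans (isolate (+ c) (e ℤ.* + N)) (≡.trans (cong (λ z → z ℤ.- e ℤ.* + N) (≡.trans (≡.sym eq) eq′)) (factor q e (+ N)))))
    where
    isolate : ∀ c d → c ≡ c ℤ.+ d ℤ.- d
    isolate = solve-∀
    factor : ∀ q e n → q ℤ.* n ℤ.- e ℤ.* n ≡ (q ℤ.- e) ℤ.* n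
    factor = solve-∀

module Conjugation {c ℓ} (F : Field c ℓ) {p m u : ℕ} (pp : Prime p) (2<p : 2 < p) (m≥3 : 3 ≤ m)
  (coprimeᵖ : Coprime p m) (order : IsOrderMod p (2 ℕ.* m) u)
  (char : FieldOps.HasChar F p) (closed : FieldOps.AlgClosed F) where
  open Field F hiding (zero)
  open FieldOps F using (evalℤ; zpow; MinPolyDegree)
  open FieldTheory F
  open CommutativeExp commutativeSemiring using (^-distrib-*)
  open CyclotomicRoots F closed
  open PeriodArithmetic p m u m≥3 order
  open Relation.Binary.Reasoning.Setoid setoid

  ι-char : ι (+ p) ≈ 0#
  ι-char = trans (reflexive (≡.sym (fromℕ≡ι p))) char

  open Frobenius F pp ι-char

  module _ {ζ₄ ζ : Carrier} (root₄ : evalℤ (cyclotomic 4) ζ₄ ≈ 0#) (root : evalℤ (cyclotomic (2 ℕ.* m)) ζ ≈ 0#)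
    {n : ℕ} (cop : Coprime n m) where

    private
      N = 2 ℕ.* m

      1≤m : 1 ≤ m
      1≤m = ℕₚ.≤-trans (s≤s z≤n) m≥3

      1≤N : 1 ≤ N
      1≤N = ℕₚ.≤-trans 1≤m (ℕₚ.m≤m+n m _)

      N≉0 : ι (+ N) ≉ 0#
      N≉0 = coprime≉0 (coprime-2m pp 2<p coprimeᵖ)

      ζ^N≈1 : ζ ^ N ≈ 1#
      ζ^N≈1 = cyclotomic-root-power 1≤N N≉0 root

      order-ζ : ∀ k → ζ ^ k ≈ 1# → N ∣ k
      order-ζ = cyclotomic-root-order 1≤N N≉0 root

      multiple-order-ζ : ∀ {k} → N ∣ k → ζ ^ k ≈ 1#
      multiple-order-ζ (divides q ≡.refl) = power-of-one ζ^N≈1 q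

      ζ≉0 : ζ ≉ 0#
      ζ≉0 ζ≈0 = 1≉0 (trans (sym ζ^N≈1) (go 1≤N))
        where
        go : ∀ {k} → 1 ≤ k → ζ ^ k ≈ 0#
        go {suc k} _ = trans (*-congʳ ζ≈0) (zeroˡ _)

      x+1≈0⇒x≈-1 : ∀ {x} → x + 1# ≈ 0# → x ≈ - 1#
      x+1≈0⇒x≈-1 {x} eq = trans (solve 2 (λ x o → x := (x :+ o) :- o) refl x 1#) (trans (+-congʳ eq) (+-identityˡ _))

      -1*-1≈1 : - 1# * - 1# ≈ 1#
      -1*-1≈1 = trans (solve 1 (λ o → (:- o) :* (:- o) := o :* o) refl 1#) (*-identityˡ 1#)

      ζ^m≈-1 : ζ ^ m ≈ - 1#
      ζ^m≈-1 = x+1≈0⇒x≈-1 (*-cancel-0 (λ eq → N∤m (order-ζ m (x-y≈0⇒x≈y eq))) (begin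
        (ζ ^ m - 1#) * (ζ ^ m + 1#)
          ≈⟨ solve 2 (λ x o → (x :- o) :* (x :+ o) := x :* x :- o :* o) refl (ζ ^ m) 1# ⟩
        ζ ^ m * ζ ^ m - 1# * 1#
          ≈⟨ +-cong (sym (^-homo-* ζ m m)) (-‿cong (*-identityˡ 1#)) ⟩
        ζ ^ (m ℕ.+ m) - 1#
          ≈⟨ x≈y⇒x-y≈0 (trans (^-congʳ ζ (cong (m ℕ.+_) (≡.sym (ℕₚ.+-identityʳ m)))) ζ^N≈1) ⟩
        0# ∎))
        where
        N∤m : ¬ (N ∣ m)
        N∤m N∣m = ℕₚ.<⇒≱ (ℕₚ.m<m+n m (ℕₚ.≤-trans 1≤m (ℕₚ.m≤m+n m 0))) (∣⇒≤ {{ℕ.>-nonZero 1≤m}} N∣m)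

      η θ α : Carrier
      η = ζ ^ n
      θ = (ζ ⁻¹) ^ n
      α = ζ₄ * (η + θ)

      θη≈1 : ∀ k → θ ^ k * η ^ k ≈ 1#
      θη≈1 k = trans (sym (^-distrib-* θ η k)) (trans (^-congˡ k
        (trans (sym (^-distrib-* (ζ ⁻¹) ζ n)) (trans (^-congˡ n (inverse ζ ζ≉0)) (1^n≈1 n)))) (1^n≈1 k))

      η≈1⇒ : ∀ {x} → Even x → η ^ x ≈ 1# → N ∣ x
      η≈1⇒ {x} even eq = divides-cofactor cop even (order-ζ _ (trans (sym (^-assocʳ ζ n x)) eq))

      η≈1⇐ : ∀ {x} → N ∣ x → η ^ x ≈ 1#
      η≈1⇐ {x} N∣x = trans (^-assocʳ ζ n x) (multiple-order-ζ (∣n⇒∣m*n n N∣x))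

      η≈-1⇒ : ∀ {x} → Even x → η ^ x ≈ - 1# → N ∣ x ℕ.+ m
      η≈-1⇒ {x} even eq = divides-cofactor-+ cop even (order-ζ _ (begin
        ζ ^ (n ℕ.* x ℕ.+ m)      ≈⟨ ^-homo-* ζ (n ℕ.* x) m ⟩
        ζ ^ (n ℕ.* x) * ζ ^ m   ≈⟨ *-cong (trans (sym (^-assocʳ ζ n x)) eq) ζ^m≈-1 ⟩
        - 1# * - 1#               ≈⟨ -1*-1≈1 ⟩
        1#                        ∎))

      η≈-1⇐ : ∀ {x} → Even x → N ∣ x ℕ.+ m → η ^ x ≈ - 1#
      η≈-1⇐ {x} even N∣ = begin
        η ^ x                            ≈⟨ ^-assocʳ ζ n x ⟩
        ζ ^ (n ℕ.* x)                    ≈⟨ *-identityʳ _ ⟨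
        ζ ^ (n ℕ.* x) * 1#               ≈⟨ *-congˡ -1*-1≈1 ⟨
        ζ ^ (n ℕ.* x) * (- 1# * - 1#)    ≈⟨ *-assoc _ _ _ ⟨
        ζ ^ (n ℕ.* x) * - 1# * - 1#      ≈⟨ *-congʳ (*-congˡ ζ^m≈-1) ⟨
        ζ ^ (n ℕ.* x) * ζ ^ m * - 1#    ≈⟨ *-congʳ (^-homo-* ζ (n ℕ.* x) m) ⟨
        ζ ^ (n ℕ.* x ℕ.+ m) * - 1#       ≈⟨ *-congʳ (multiple-order-ζ (divides-+-cofactor cop even N∣)) ⟩
        1# * - 1#                         ≈⟨ *-identityˡ _ ⟩
        - 1#                              ∎

      ζ₄²≈-1 : ζ₄ * ζ₄ ≈ - 1#
      ζ₄²≈-1 = x+1≈0⇒x≈-1 (trans (+-congˡ (sym ι-1)) (trans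
        -- `cyclotomic 4` computes to the coefficients 1, 0, 1; the right-hand side is their Horner
        -- form.
        (solve 1 (λ z → z :* z :+ con (+ 1) := con (+ 1) :+ z :* (con (+ 0) :+ z :* (con (+ 1) :+ z :* con (+ 0)))) refl ζ₄)
        (trans (reflexive (≡.sym (evalℤ≡eval (cyclotomic 4) ζ₄))) root₄)))

      ζ₄≉0 : ζ₄ ≉ 0#
      ζ₄≉0 ζ₄≈0 = 1≉0 (begin
        1#            ≈⟨ -1*-1≈1 ⟨
        - 1# * - 1#   ≈⟨ *-congʳ ζ₄²≈-1 ⟨
        ζ₄ * ζ₄ * - 1# ≈⟨ *-congʳ (trans (*-congʳ ζ₄≈0) (zeroˡ _)) ⟩
        0# * - 1#     ≈⟨ zeroˡ _ ⟩
        0#            ∎)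

      square-power : ∀ x j → x ^ (j ℕ.+ j) ≈ (x * x) ^ j
      square-power x j = trans (^-homo-* x j j) (sym (^-distrib-* x x j))

      -1^even : ∀ i → (- 1#) ^ (i ℕ.+ i) ≈ 1#
      -1^even i = trans (square-power (- 1#) i) (trans (^-congˡ i -1*-1≈1) (1^n≈1 i))

      ζ₄^[1+4i] : ∀ i → ζ₄ ^ suc ((i ℕ.+ i) ℕ.+ (i ℕ.+ i)) ≈ 1# * ζ₄
      ζ₄^[1+4i] i = trans (*-congˡ (trans (square-power ζ₄ (i ℕ.+ i))
        (trans (^-congˡ (i ℕ.+ i) ζ₄²≈-1) (-1^even i)))) (*-comm ζ₄ 1#)

      ζ₄^[3+4i] : ∀ i → ζ₄ ^ suc (suc (i ℕ.+ i) ℕ.+ suc (i ℕ.+ i)) ≈ - 1# * ζ₄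
      ζ₄^[3+4i] i = trans (*-congˡ (trans (square-power ζ₄ (suc (i ℕ.+ i)))
        (trans (^-congˡ (suc (i ℕ.+ i)) ζ₄²≈-1) (trans (*-congˡ (-1^even i)) (*-identityʳ _))))) (*-comm ζ₄ (- 1#))

      α^p^k : ∀ k → α ^ (p ℕ.^ k) ≈ ζ₄ ^ (p ℕ.^ k) * (η ^ (p ℕ.^ k) + θ ^ (p ℕ.^ k))
      α^p^k k = trans (^-distrib-* ζ₄ (η + θ) (p ℕ.^ k)) (*-congˡ (frobeniusᵏ-+ k η θ))

      η≈θ : ∀ {e} q → η ^ suc q ≈ e → η ≈ e * θ ^ q
      η≈θ {e} q eq = begin
        η                               ≈⟨ *-identityʳ η ⟨
        η * 1#                          ≈⟨ *-congˡ (θη≈1 q) ⟨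
        η * (θ ^ q * η ^ q)           ≈⟨ solve 3 (λ h t k → h :* (t :* k) := (h :* k) :* t) refl η (θ ^ q) (η ^ q) ⟩
        η ^ suc q * θ ^ q             ≈⟨ *-congʳ eq ⟩
        e * θ ^ q                      ∎

      θ≈η : ∀ {e} q → η ≈ e * θ ^ q → η ^ suc q ≈ e
      θ≈η {e} q eq = begin
        η * η ^ q               ≈⟨ *-congʳ eq ⟩
        e * θ ^ q * η ^ q      ≈⟨ *-assoc _ _ _ ⟩
        e * (θ ^ q * η ^ q)    ≈⟨ *-congˡ (θη≈1 q) ⟩
        e * 1#                   ≈⟨ *-identityʳ e ⟩
        e                        ∎

      -- In the middle steps the constant 1 marks the places where it is exchanged for e² and for θᵗ ηᵗ.
      sum-factors : ∀ {e} → e * e ≈ 1# → ∀ t →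
        (η ^ suc t + θ ^ suc t) - e * (η + θ) ≈ (η ^ t - e) * (η - e * θ ^ suc t)
      sum-factors {e} e² t = begin
        (η * ηᵗ + θ * θᵗ) - e * (η + θ)
          ≈⟨ solve 5 (λ e h t a b → (h :* a :+ t :* b) :- e :* (h :+ t)
               := (h :* a :+ con (+ 1) :* (t :* b)) :- e :* (h :+ t :* con (+ 1))) refl e η θ ηᵗ θᵗ ⟩
        (η * ηᵗ + ι (+ 1) * (θ * θᵗ)) - e * (η + θ * ι (+ 1))
          ≈⟨ +-cong (+-congˡ (*-congʳ (trans ι-1 (sym e²))))
               (-‿cong (*-congˡ (+-congˡ (*-congˡ (trans ι-1 (sym (θη≈1 t))))))) ⟩
        (η * ηᵗ + e * e * (θ * θᵗ)) - e * (η + θ * (θᵗ * ηᵗ))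
          ≈⟨ solve 5 (λ e h t a b → (h :* a :+ e :* e :* (t :* b)) :- e :* (h :+ t :* (b :* a))
               := (a :- e) :* (h :- e :* (t :* b))) refl e η θ ηᵗ θᵗ ⟩
        (ηᵗ - e) * (η - e * (θ * θᵗ)) ∎
        where
        ηᵗ = η ^ t
        θᵗ = θ ^ t

      -- Here q = t + 1 and `e` is the sign in ζ₄^q = e ζ₄, so the exponents q - 1 and q + 1 become
      -- `t` and `suc (suc t)` without subtraction.
      fixed⇒factors : ∀ {e} → e * e ≈ 1# → ∀ t → ζ₄ * (η + θ) ≈ (e * ζ₄) * (η ^ suc t + θ ^ suc t) →
        ¬ ¬ (η ^ t ≈ e ⊎ η ^ suc (suc t) ≈ e)
      fixed⇒factors {e} e² t eq none = no-zero-divisors (trans (sym (sum-factors e² t)) sum≈) λ where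
          (inj₁ eq₁) → none (inj₁ (x-y≈0⇒x≈y eq₁))
          (inj₂ eq₂) → none (inj₂ (θ≈η (suc t) (x-y≈0⇒x≈y eq₂)))
        where
        X = η ^ suc t + θ ^ suc t
        sum≈ : X - e * (η + θ) ≈ 0#
        sum≈ = *-cancel-0 ζ₄≉0 (begin
          ζ₄ * (X - e * (η + θ))
            ≈⟨ solve 4 (λ z x e y → z :* (x :- e :* y) := z :* x :- e :* (z :* y)) refl ζ₄ X e (η + θ) ⟩
          ζ₄ * X - e * (ζ₄ * (η + θ))
            ≈⟨ +-congˡ (-‿cong (*-congˡ eq)) ⟩
          ζ₄ * X - e * ((e * ζ₄) * X)
            ≈⟨ solve 3 (λ z x e → z :* x :- e :* ((e :* z) :* x) := (con (+ 1) :- e :* e) :* (z :* x)) refl ζ₄ X e ⟩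
          (ι (+ 1) - e * e) * (ζ₄ * X)
            ≈⟨ *-congʳ (x≈y⇒x-y≈0 (trans ι-1 (sym e²))) ⟩
          0# * (ζ₄ * X)
            ≈⟨ zeroˡ _ ⟩
          0# ∎)

      factors⇒fixed : ∀ {e} → e * e ≈ 1# → ∀ t → η ^ t ≈ e ⊎ η ^ suc (suc t) ≈ e →
        (e * ζ₄) * (η ^ suc t + θ ^ suc t) ≈ ζ₄ * (η + θ)
      factors⇒fixed {e} e² t eq = begin
        (e * ζ₄) * (η ^ suc t + θ ^ suc t)  ≈⟨ *-congˡ (x-y≈0⇒x≈y (trans (sum-factors e² t) (product≈0 eq))) ⟩
        (e * ζ₄) * (e * (η + θ))              ≈⟨ solve 3 (λ e z y → (e :* z) :* (e :* y) := (e :* e) :* (z :* y)) refl e ζ₄ _ ⟩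
        (e * e) * (ζ₄ * (η + θ))              ≈⟨ *-congʳ e² ⟩
        1# * (ζ₄ * (η + θ))                   ≈⟨ *-identityˡ _ ⟩
        ζ₄ * (η + θ)                          ∎
        where
        product≈0 : η ^ t ≈ e ⊎ η ^ suc (suc t) ≈ e → (η ^ t - e) * (η - e * θ ^ suc t) ≈ 0#
        product≈0 (inj₁ eq₁) = trans (*-congʳ (x≈y⇒x-y≈0 eq₁)) (zeroˡ _)
        product≈0 (inj₂ eq₂) = trans (*-congˡ (x≈y⇒x-y≈0 (η≈θ (suc t) eq₂))) (zeroʳ _)

      1≋ : ∀ t → + suc t ℤ.- + 1 ≡ + t ℤ.+ + 0 ℤ.* + N
      1≋ t = ≡.trans (ℤₚ.⊖-≥ {suc t} {1} (s≤s z≤n)) (≡.sym (≡.trans (cong (λ z → + t ℤ.+ z) (ℤₚ.*-zeroˡ (+ N))) (ℤₚ.+-identityʳ (+ t))))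

      -1≋ : ∀ t → + suc t ℤ.- (ℤ.- + 1) ≡ + suc (suc t) ℤ.+ + 0 ℤ.* + N
      -1≋ t = ≡.trans (cong +_ (ℕₚ.+-comm (suc t) 1)) (≡.sym (≡.trans (cong (λ z → + suc (suc t) ℤ.+ z) (ℤₚ.*-zeroˡ (+ N))) (ℤₚ.+-identityʳ _)))

      -- The quotient -1 turns t - m into t + m. This is the exponent for the test η^t = -1, because
      -- ζ^m = -1.
      m+1≋ : ∀ t → + suc t ℤ.- + (m ℕ.+ 1) ≡ + (t ℕ.+ m) ℤ.+ -[1+ 0 ] ℤ.* + N
      m+1≋ t = ≡.trans (identity (+ t) (+ m)) (cong (λ z → + t ℤ.+ + m ℤ.+ -[1+ 0 ] ℤ.* z) (≡.sym (ℤₚ.pos-* 2 m)))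
        where
        identity : ∀ t m → (+ 1 ℤ.+ t) ℤ.- (m ℤ.+ + 1) ≡ t ℤ.+ m ℤ.+ -[1+ 0 ] ℤ.* (+ 2 ℤ.* m)
        identity = solve-∀

      m-1≋ : ∀ t → + suc t ℤ.- + (m ∸ 1) ≡ + (suc (suc t) ℕ.+ m) ℤ.+ -[1+ 0 ] ℤ.* + N
      m-1≋ t = ≡.trans (cong (λ z → + suc t ℤ.- z) (≡.sym (ℤₚ.⊖-≥ {m} {1} 1≤m)))
        (≡.trans (identity (+ t) (+ m)) (cong (λ z → + 2 ℤ.+ + t ℤ.+ + m ℤ.+ -[1+ 0 ] ℤ.* z) (≡.sym (ℤₚ.pos-* 2 m))))
        where
        identity : ∀ t m → (+ 1 ℤ.+ t) ℤ.- (m ℤ.- + 1) ≡ + 2 ℤ.+ t ℤ.+ m ℤ.+ -[1+ 0 ] ℤ.* (+ 2 ℤ.* m)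
        identity = solve-∀

      1+4i≡1 : ∀ i → + suc ((i ℕ.+ i) ℕ.+ (i ℕ.+ i)) ≡ᵢ + 1 [mod 4 ]
      1+4i≡1 i = mod-congruence {b = + 1} (by (+ i) (identity (+ i)))
        where
        identity : ∀ i → + 1 ℤ.+ ((i ℤ.+ i) ℤ.+ (i ℤ.+ i)) ≡ + 1 ℤ.+ i ℤ.* + 4
        identity = solve-∀

      3+4i≡3 : ∀ i → + suc (suc (i ℕ.+ i) ℕ.+ suc (i ℕ.+ i)) ≡ᵢ + 3 [mod 4 ]
      3+4i≡3 i = mod-congruence {b = + 3} (by (+ i) (identity (+ i)))
        where
        identity : ∀ i → + 1 ℤ.+ ((+ 1 ℤ.+ (i ℤ.+ i)) ℤ.+ (+ 1 ℤ.+ (i ℤ.+ i))) ≡ + 3 ℤ.+ i ℤ.* + 4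
        identity = solve-∀

      -- The doubled form of q - 1 makes its evenness hold by `refl` and reduces ζ₄^(q-1) to a power
      -- of ζ₄² = -1.
      data OddPower (k : ℕ) : Set where
        one : ∀ i → p ℕ.^ k ≡ suc ((i ℕ.+ i) ℕ.+ (i ℕ.+ i)) → OddPower k
        three : ∀ i → p ℕ.^ k ≡ suc (suc (i ℕ.+ i) ℕ.+ suc (i ℕ.+ i)) → OddPower k

      odd-power-mod4 : ∀ k → OddPower k
      odd-power-mod4 k with odd-power (odd-prime pp 2<p) k
      ... | j , eq with parity j
      ...   | inj₁ (i , ≡.refl) = one i eq
      ...   | inj₂ (i , ≡.refl) = three i eq

      even+2 : ∀ {t} → Even t → Even (suc (suc t))
      even+2 (k , ≡.refl) = suc k , cong suc (≡.sym (ℕₚ.+-suc k k))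

      α^ : ∀ k {t e} → p ℕ.^ k ≡ suc t → ζ₄ ^ suc t ≈ e * ζ₄ → α ^ (p ℕ.^ k) ≈ (e * ζ₄) * (η ^ suc t + θ ^ suc t)
      α^ k q≡ eq = trans (α^p^k k)
        (trans (reflexive (cong (λ q → ζ₄ ^ q * (η ^ q + θ ^ q)) q≡)) (*-congʳ eq))

      -- `Periodic` as a property of the number q = p^k, so that it can be transported along q = t +
      -- 1.
      PeriodicPower : ℕ → Set
      PeriodicPower q =
        (+ q ≡ᵢ + 1 [mod 4 ] × (+ q ≡ᵢ + 1 [mod N ] ⊎ + q ≡ᵢ ℤ.- + 1 [mod N ])) ⊎
        (+ q ≡ᵢ + 3 [mod 4 ] × (+ q ≡ᵢ + (m ℕ.+ 1) [mod N ] ⊎ + q ≡ᵢ + (m ∸ 1) [mod N ]))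

    fixed⇒periodic : ∀ k → α ^ (p ℕ.^ k) ≈ α → ¬ ¬ Periodic k
    fixed⇒periodic k fixed none with odd-power-mod4 k
    ... | one i q≡ = fixed⇒factors (*-identityˡ 1#) t (trans (sym fixed) (α^ k q≡ (ζ₄^[1+4i] i))) λ where
        (inj₁ eq) → none (subst PeriodicPower (≡.sym q≡)
          (inj₁ (1+4i≡1 i , inj₁ (divides⇒congruent (+ suc t) (+ 1) (+ 0) (1≋ t) (η≈1⇒ even eq)))))
        (inj₂ eq) → none (subst PeriodicPower (≡.sym q≡)
          (inj₁ (1+4i≡1 i , inj₂ (divides⇒congruent (+ suc t) (ℤ.- + 1) (+ 0) (-1≋ t) (η≈1⇒ (even+2 even) eq)))))
      where
      t = (i ℕ.+ i) ℕ.+ (i ℕ.+ i)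
      even : Even t
      even = i ℕ.+ i , ≡.refl
    ... | three i q≡ = fixed⇒factors -1*-1≈1 t (trans (sym fixed) (α^ k q≡ (ζ₄^[3+4i] i))) λ where
        (inj₁ eq) → none (subst PeriodicPower (≡.sym q≡)
          (inj₂ (3+4i≡3 i , inj₁ (divides⇒congruent (+ suc t) (+ (m ℕ.+ 1)) -[1+ 0 ] (m+1≋ t) (η≈-1⇒ even eq)))))
        (inj₂ eq) → none (subst PeriodicPower (≡.sym q≡)
          (inj₂ (3+4i≡3 i , inj₂ (divides⇒congruent (+ suc t) (+ (m ∸ 1)) -[1+ 0 ] (m-1≋ t) (η≈-1⇒ (even+2 even) eq)))))
      where
      t = suc (i ℕ.+ i) ℕ.+ suc (i ℕ.+ i)
      even : Even t
      even = suc (i ℕ.+ i) , ≡.refl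

    periodic⇒fixed : ∀ k → Periodic k → α ^ (p ℕ.^ k) ≈ α
    periodic⇒fixed k periodic with odd-power-mod4 k
    ... | one i q≡ = trans (α^ k q≡ (ζ₄^[1+4i] i))
        (factors⇒fixed (*-identityˡ 1#) t (factors (subst PeriodicPower q≡ periodic)))
      where
      t = (i ℕ.+ i) ℕ.+ (i ℕ.+ i)
      factors : PeriodicPower (suc t) → η ^ t ≈ 1# ⊎ η ^ suc (suc t) ≈ 1#
      factors (inj₁ (_ , inj₁ eq)) = inj₁ (η≈1⇐ (congruent⇒divides (+ suc t) (+ 1) (+ 0) (1≋ t) eq))
      factors (inj₁ (_ , inj₂ eq)) = inj₂ (η≈1⇐ (congruent⇒divides (+ suc t) (ℤ.- + 1) (+ 0) (-1≋ t) eq))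
      factors (inj₂ (≡3 , _)) = ⊥-elim (1≢3 {+ suc t} (congruent (1+4i≡1 i)) (congruent ≡3))
    ... | three i q≡ = trans (α^ k q≡ (ζ₄^[3+4i] i))
        (factors⇒fixed -1*-1≈1 t (factors (subst PeriodicPower q≡ periodic)))
      where
      t = suc (i ℕ.+ i) ℕ.+ suc (i ℕ.+ i)
      even : Even t
      even = suc (i ℕ.+ i) , ≡.refl
      factors : PeriodicPower (suc t) → η ^ t ≈ - 1# ⊎ η ^ suc (suc t) ≈ - 1#
      factors (inj₁ (≡1 , _)) = ⊥-elim (1≢3 {+ suc t} (congruent ≡1) (congruent (3+4i≡3 i)))
      factors (inj₂ (_ , inj₁ eq)) = inj₁ (η≈-1⇐ even (congruent⇒divides (+ suc t) (+ (m ℕ.+ 1)) -[1+ 0 ] (m+1≋ t) eq))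
      factors (inj₂ (_ , inj₂ eq)) = inj₂ (η≈-1⇐ (even+2 even) (congruent⇒divides (+ suc t) (+ (m ∸ 1)) -[1+ 0 ] (m-1≋ t) eq))

    periodic? : ∀ k → Dec (Periodic k)
    periodic? k =
      ((4 ∣? _) ×-dec ((N ∣? _) ⊎-dec (N ∣? _))) ⊎-dec
      ((4 ∣? _) ×-dec ((N ∣? _) ⊎-dec (N ∣? _)))

    -- `Periodic` is a decidable statement about integers, so the double negations inherited from
    -- the field end here. The element β leaves room for the form of α with integer exponents.
    minimal-degree-characterised : ∀ {β δ} → β ≈ α → MinPolyDegree p β δ →
      (1 ≤ δ × Periodic δ) × (∀ {k} → 1 ≤ k → Periodic k → δ ≤ k)
    minimal-degree-characterised {β} {δ} β≈α min =
      decidable-stable ((1 ℕₚ.≤? δ) ×-dec periodic? δ) (λ none →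
        minimal-degree-periodic min λ (1≤δ , fixed) →
          fixed⇒periodic δ (trans (^-congˡ (p ℕ.^ δ) (sym β≈α)) (trans fixed β≈α)) λ per → none (1≤δ , per)) ,
      λ {k} 1≤k per → minimal-degree-≤ min 1≤k
        (trans (^-congˡ (p ℕ.^ k) β≈α) (trans (periodic⇒fixed k per) (sym β≈α)))

  -- The sign of s only exchanges the two summands, which is why natural exponents suffice above.
  zpow-sum : ∀ ζ s → zpow ζ s + zpow ζ (ℤ.- s) ≈ ζ ^ ∣ s ∣ + (ζ ⁻¹) ^ ∣ s ∣
  zpow-sum ζ (+ zero) = refl
  zpow-sum ζ (+ suc n) = +-cong (reflexive (pow≈^ ζ (suc n))) (reflexive (pow≈^ (ζ ⁻¹) (suc n)))
  zpow-sum ζ -[1+ n ] = trans (+-comm _ _)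
    (+-cong (reflexive (pow≈^ ζ (suc n))) (reflexive (pow≈^ (ζ ⁻¹) (suc n))))

-- The degree of ζ₄ (ζ^s + ζ^(-s)) over ℤ_p in terms of u

open import Data.Nat using (ℕ; _*_; _+_; _∸_; _/_; _^_; _>_; _≥_)
open import Data.Integer using (ℤ; +_; -_; ∣_∣)

theorem5p5 : ∀ {c ℓ} (F : Field c ℓ) (p m u : ℕ) → Prime p → p > 2 → m ≥ 3 → Coprime p m
    → IsOrderMod p (2 * m) u
    → FieldOps.HasChar F p → FieldOps.AlgClosed F
    → (ζ₄ ζ₂ₘ : Field.Carrier F)
    → Field._≈_ F (FieldOps.evalℤ F (cyclotomic 4) ζ₄) (Field.0# F)
    → Field._≈_ F (FieldOps.evalℤ F (cyclotomic (2 * m)) ζ₂ₘ) (Field.0# F)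
    → (s : ℤ) → Coprime ∣ s ∣ m
    → (δ : ℕ)
    → FieldOps.MinPolyDegree F p
    (Field._*_ F ζ₄ (Field._+_ F (FieldOps.zpow F ζ₂ₘ s) (FieldOps.zpow F ζ₂ₘ (- s)))) δ
    →
    ((+ p ≡ᵢ + 1 [mod 4 ] × + u ≡ᵢ + 0 [mod 2 ] × + (p ^ (u / 2)) ≡ᵢ - + 1 [mod 2 * m ] → δ ≡ u / 2)
    × (+ p ≡ᵢ + 3 [mod 4 ] × + u ≡ᵢ + 0 [mod 4 ] × + (p ^ (u / 2)) ≡ᵢ - + 1 [mod 2 * m ] → δ ≡ u / 2)
    × (+ p ≡ᵢ + 3 [mod 4 ] × + u ≡ᵢ + 2 [mod 4 ]
    × (+ (p ^ (u / 2)) ≡ᵢ + (m + 1) [mod 2 * m ] ⊎ + (p ^ (u / 2)) ≡ᵢ + (m ∸ 1) [mod 2 * m ])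
    → δ ≡ u / 2)
    × (+ p ≡ᵢ + 1 [mod 4 ] × + u ≡ᵢ + 0 [mod 2 ] × ¬ (+ (p ^ (u / 2)) ≡ᵢ - + 1 [mod 2 * m ]) → δ ≡ u)
    × (+ p ≡ᵢ + 1 [mod 4 ] × + u ≡ᵢ + 1 [mod 2 ] → δ ≡ u)
    × (+ p ≡ᵢ + 3 [mod 4 ] × + u ≡ᵢ + 0 [mod 4 ] × ¬ (+ (p ^ (u / 2)) ≡ᵢ - + 1 [mod 2 * m ]) → δ ≡ u)
    × (+ p ≡ᵢ + 3 [mod 4 ] × + u ≡ᵢ + 2 [mod 4 ]
    × ¬ (+ (p ^ (u / 2)) ≡ᵢ + (m + 1) [mod 2 * m ] ⊎ + (p ^ (u / 2)) ≡ᵢ + (m ∸ 1) [mod 2 * m ])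
    → δ ≡ u)
    × (+ p ≡ᵢ + 3 [mod 4 ] × + u ≡ᵢ + 1 [mod 2 ] → δ ≡ 2 * u))
theorem5p5 F p m u pp p>2 m≥3 coprimeᵖ order char closed ζ₄ ζ₂ₘ root₄ root s coprimeˢ δ min =
  degree-1-half 1≤δ periodic minimal , degree-3-0-half 1≤δ periodic minimal , degree-3-2-half 1≤δ periodic minimal ,
  degree-1-full 1≤δ periodic minimal , degree-1-odd 1≤δ periodic minimal , degree-3-0-full 1≤δ periodic minimal ,
  degree-3-2-full 1≤δ periodic minimal , degree-3-odd 1≤δ periodic minimal
  where
  open PeriodArithmetic p m u m≥3 order
  open Conjugation F pp p>2 m≥3 coprimeᵖ order char closed
  characterised = minimal-degree-characterised root₄ root {∣ s ∣} coprimeˢ (Field.*-congˡ F (zpow-sum ζ₂ₘ s)) min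
  1≤δ = proj₁ (proj₁ characterised)
  periodic = proj₂ (proj₁ characterised)
  minimal = proj₂ characterised
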